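{- Let $n\ge 0$ and $d\ge 1$ be integers, let $\gamma_{n/d}=\sqrt{1-\frac{n^2}{(n+d)^2}}$, and consider the bivariate polynomial $$f(x,y)=d(x^2-1)y^2+2nxy-(2n+d).$$ Let $s>\gamma_{n/d}$ and $t>0$ be real numbers with $f(s,t)\ge 0$. Then $$\mathcal{G}_{C_d^{(n+1)}}(s)\le t .$$
   Context: For real $a>0$, the Gegenbauer polynomials $C_m^{(a)}(x)$ are defined by $\sum_{m\ge 0}C_m^{(a)}(x)t^m=(1-2xt+t^2)^{ -a}$. For a nonconstant polynomial $p$, its Cauchy transform is $\mathcal{G}_p(x)=\frac{1}{\deg p}\,\frac{p'(x)}{p(x)}$. -}

module Defs where

open import Level using (Level; _⊔_) renaming (suc to lsuc)
open import Data.Nat.Base as ℕ using (ℕ; zero; suc; NonZero)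
import Data.Nat.Properties as ℕₚ
open import Data.List.Base using (List; []; _∷_; map; foldr; applyUpTo)
open import Data.Product.Base using (∃-syntax; _×_; proj₁)
open import Data.Sum.Base using (_⊎_; inj₂)
open import Function.Bundles using (_⇔_; Equivalence)
open import Relation.Nullary.Negation using (¬_)
open import Relation.Binary.Core using (Rel)
open import Relation.Binary.Structures using (IsStrictPartialOrder)
open import Algebra.Bundles using (CommutativeRing; Semiring)
open import Algebra.Apartness.Bundles using (HeytingField)
import Algebra.Definitions.RawSemiring as RawSemiringDefinitions

-- The real numbers, given axiomatically as a Cauchy-complete archimedean
-- ordered field.  With excluded middle this characterises ℝ up to unique
-- isomorphism.  The axioms are phrased with apartness, so that they also hold
-- constructively (for instance for the Dedekind reals); cotransitivity of _<_
-- follows from that of _#_.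
record RealNumbers (c ℓ₁ ℓ₂ ℓ₃ : Level)
                   : Set (lsuc (c ⊔ ℓ₁ ⊔ ℓ₂ ⊔ ℓ₃)) where
  infix 4 _<_ _≤_
  infixl 7 _÷_
  field
    heytingField : HeytingField c ℓ₁ ℓ₂

  open HeytingField heytingField public

  commutativeRing : CommutativeRing c ℓ₁
  commutativeRing =
    record { isCommutativeRing = isCommutativeRing }

  open RawSemiringDefinitions
    (Semiring.rawSemiring (CommutativeRing.semiring commutativeRing))
    public using (_^_) renaming (_×_ to _·_)

  fromℕ : ℕ → Carrier
  fromℕ n = n · 1#

  field
    _<_                  : Rel Carrier ℓ₃
    isStrictPartialOrder : IsStrictPartialOrder _≈_ _<_
    #⇔<⊎>                : ∀ x y → (x # y) ⇔ (x < y ⊎ y < x)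
    0<1                  : 0# < 1#
    +-monoˡ-<            : ∀ {x y} z → x < y → x + z < y + z
    *-pos                : ∀ {x y} → 0# < x → 0# < y → 0# < x * y
    archimedean          : ∀ x → ∃[ n ] x < fromℕ n

  module < = IsStrictPartialOrder isStrictPartialOrder

  _≤_ : Rel Carrier ℓ₃
  x ≤ y = ¬ (y < x)

  -- ∣ x - y ∣ < ε
  Within : Carrier → Carrier → Carrier → Set ℓ₃
  Within ε x y = (x < y + ε) × (y < x + ε)

  Cauchy : (ℕ → Carrier) → Set (c ⊔ ℓ₃)
  Cauchy u = ∀ ε → 0# < ε →
    ∃[ N ] (∀ i j → N ℕ.≤ i → N ℕ.≤ j → Within ε (u i) (u j))

  Converges : (ℕ → Carrier) → Carrier → Set (c ⊔ ℓ₃)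
  Converges u l = ∀ ε → 0# < ε →
    ∃[ N ] (∀ i → N ℕ.≤ i → Within ε (u i) l)

  field
    complete : ∀ u → Cauchy u → ∃[ l ] Converges u l

  recip : ∀ x → x # 0# → Carrier
  recip x x#0 = proj₁ (#⇒invertible x#0)

  0<fromℕ : ∀ k → 0# < fromℕ (suc k)
  0<fromℕ zero    = <.<-respʳ-≈ (sym (+-identityʳ 1#)) 0<1
  0<fromℕ (suc k) = <.trans (0<fromℕ k)
    (<.<-respˡ-≈ (+-identityˡ _) (+-monoˡ-< (fromℕ (suc k)) 0<1))

  fromℕ#0 : ∀ k .{{_ : NonZero k}} → fromℕ k # 0#
  fromℕ#0 (suc k) = Equivalence.from (#⇔<⊎> _ _) (inj₂ (0<fromℕ k))

  _÷_ : Carrier → (k : ℕ) .{{_ : NonZero k}} → Carrier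
  x ÷ k = x * recip (fromℕ k) (fromℕ#0 k)

  IsSqrt : Carrier → Carrier → Set (ℓ₁ ⊔ ℓ₃)
  IsSqrt r a = 0# ≤ r × r ^ 2 ≈ a


module Gegenbauer {c ℓ₁ ℓ₂ ℓ₃ : Level} (R : RealNumbers c ℓ₁ ℓ₂ ℓ₃) where
  open RealNumbers R

  -- Coefficient lists, constant term first; trailing zeros are allowed.
  Poly : Set c
  Poly = List Carrier

  infixl 6 _⊕_
  infixl 7 _⊗_

  _⊕_ : Poly → Poly → Poly
  []      ⊕ q       = q
  (a ∷ p) ⊕ []      = a ∷ p
  (a ∷ p) ⊕ (b ∷ q) = (a + b) ∷ (p ⊕ q)

  scale : Carrier → Poly → Poly
  scale a = map (a *_)

  _⊗_ : Poly → Poly → Poly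
  []      ⊗ q = []
  (a ∷ p) ⊗ q = scale a q ⊕ (0# ∷ (p ⊗ q))

  coeff : Poly → ℕ → Carrier
  coeff []      _       = 0#
  coeff (a ∷ p) zero    = a
  coeff (a ∷ p) (suc k) = coeff p k

  eval : Poly → Carrier → Carrier
  eval []      x = 0#
  eval (a ∷ p) x = a + x * eval p x

  -- (a + x p)′ = p + x p′
  derivative : Poly → Poly
  derivative []      = []
  derivative (a ∷ p) = p ⊕ (0# ∷ derivative p)

  HasDegree : Poly → ℕ → Set (ℓ₁ ⊔ ℓ₂)
  HasDegree p m = (coeff p m # 0#) × (∀ k → m ℕ.< k → coeff p k ≈ 0#)

  -- Formal power series in t whose coefficients are polynomials in x.
  Series : Set c
  Series = ℕ → Poly

  sumUpTo : ℕ → (ℕ → Poly) → Poly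
  sumUpTo m f = foldr _⊕_ [] (applyUpTo f (suc m))

  _⊛_ : Series → Series → Series
  (F ⊛ G) m = sumUpTo m (λ i → F i ⊗ G (m ℕ.∸ i))

  powerˢ : Series → ℕ → Series
  powerˢ F zero    zero    = 1# ∷ []
  powerˢ F zero    (suc _) = []
  powerˢ F (suc k) m       = (F ⊛ powerˢ F k) m

  -- α (α - 1) ⋯ (α - k + 1) / k!
  binomial : Carrier → ℕ → Carrier
  binomial α zero    = 1#
  binomial α (suc k) = (binomial α k * (α - fromℕ k)) ÷ suc k

  -- (1 + u)^α = Σₖ (α choose k) uᵏ, for a series u without constant term;
  -- then uᵏ does not contribute to the coefficient of tᵐ when k > m.
  onePlus_^ˢ_ : Series → Carrier → Series
  (onePlus u ^ˢ α) m = sumUpTo m (λ k → scale (binomial α k) (powerˢ u k m))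

  -- -2xt + t²
  kernel : Series
  kernel 1 = 0# ∷ (- fromℕ 2) ∷ []
  kernel 2 = 1# ∷ []
  kernel _ = []

  -- C m a is the Gegenbauer polynomial of degree index m and parameter a: the
  -- coefficient of tᵐ in (1 - 2xt + t²)^(-a).
  C : ℕ → Carrier → Poly
  C m a = (onePlus kernel ^ˢ (- a)) m

  -- p is nonconstant and its Cauchy transform is defined at x.  The degree is
  -- uniquely determined by p; it is recorded because it cannot be computed
  -- from the coefficients without deciding apartness from 0.
  record CauchyDomain (p : Poly) (x : Carrier) : Set (ℓ₁ ⊔ ℓ₂) where
    field
      degree          : ℕ
      {{nonconstant}} : NonZero degree
      hasDegree       : HasDegree p degree
      nonvanishing    : eval p x # 0#

  𝒢 : (p : Poly) (x : Carrier) → CauchyDomain p x → Carrier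
  𝒢 p x dom =
    (eval (derivative p) x * recip (eval p x) nonvanishing) ÷ degree
    where open CauchyDomain dom

  -- 1 - n² / (n + d)²
  γ² : (n d : ℕ) .{{_ : NonZero d}} → Carrier
  γ² n d = 1# - fromℕ (n ℕ.^ 2) ÷ ((n ℕ.+ d) ℕ.^ 2)
    where instance
      n+d≢0 : NonZero (n ℕ.+ d)
      n+d≢0 = ℕ.>-nonZero (ℕₚ.<-≤-trans (ℕ.>-nonZero⁻¹ d) (ℕₚ.m≤n+m d n))
      [n+d]²≢0 : NonZero ((n ℕ.+ d) ℕ.^ 2)
      [n+d]²≢0 = ℕₚ.m^n≢0 (n ℕ.+ d) 2

  f : ℕ → ℕ → Carrier → Carrier → Carrier
  f n d x y =
    fromℕ d * (x ^ 2 - 1#) * y ^ 2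
      + fromℕ (2 ℕ.* n) * x * y
      - fromℕ (2 ℕ.* n ℕ.+ d)

{-# OPTIONS --safe #-}

-- Write a = n + 1, x = s, c k = C_k^(a)(x) and e k = (C_k^(a))′(x).  The
-- generating function gives
--   e (k + 1) = x e k + (k + 2a) c k,   (k + 1) c (k + 1) = x e (k + 1) - e k.
-- For x > γ these imply, by induction on k ≤ d, that d c k ≥ (n + d) x c (k - 1),
-- so c k > 0.  The claim is the case k = d of e k ≤ k t c k.  With w = x t - 1
-- and ε = w x - t, the recurrences give
--   (k + 1) t c (k + 1) - e (k + 1) = ε e k + w (k + 2a) c k.
-- Here w ≥ 0 follows from f(x, t) ≥ 0.  If ε ≥ 0, the right-hand side is
-- nonnegative since e k ≥ 0.  If ε < 0, the induction hypothesis bounds it below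
-- by (F k + 2 w) c k, where F k = k ((x² - 1) t² - 1) + 2 n w; as F is affine in
-- k with F 0 = 2 n w ≥ 0 and F d = f(x, t) ≥ 0, it is nonnegative for k ≤ d.

module Submission where

open import Defs
open import Algebra.Bundles using (CommutativeRing)
import Algebra.Properties.Ring as RingProperties
import Algebra.Properties.Semiring.Mult as SemiringMult
import Algebra.Properties.Semiring.Mult.TCOptimised as TCMult
import Algebra.Solver.Ring as RingSolver
open import Algebra.Solver.Ring.AlmostCommutativeRing
  using (fromCommutativeRing; _-Raw-AlmostCommutative⟶_)
open import Data.Integer.Base as ℤ using (ℤ; +_; -[1+_]; _⊖_; _◃_; 0ℤ; 1ℤ)
import Data.Integer.Properties as ℤₚ
open import Data.List.Base using ([]; _∷_; foldr; applyUpTo)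
import Data.Maybe.Base as Maybe
open import Data.Nat.Base as ℕ using (ℕ; zero; suc; NonZero; z≤n; s≤s)
import Data.Nat.Properties as ℕₚ
open import Data.Product.Base using (Σ-syntax; _×_; _,_; proj₁; proj₂)
open import Data.Sign.Base as Sign using ()
open import Data.Sum.Base using (_⊎_; inj₁; inj₂)
open import Function.Bundles using (Equivalence)
open import Level using (Level; _⊔_)
open import Relation.Nullary.Negation.Core using (¬_; contradiction)
open import Relation.Nullary.Decidable using (dec⇒maybe)
open import Relation.Binary.PropositionalEquality.Core as ≡ using (_≡_)
import Relation.Binary.Reasoning.Setoid as SetoidReasoning

-- A ring solver with integer coefficients over a commutative ring.

module ℤ-CoefficientSolver {c ℓ} (A : CommutativeRing c ℓ) where
  open CommutativeRing A
  open RingProperties ring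
  open TCMult semiring using (×-homo-+; ×1-homo-*) renaming (_×_ to _·_)
  open SetoidReasoning setoid

  -- The optimised multiple reduces `1 · 1#` to `1#`, so the unit is preserved by `refl` and the
  -- literal `:1` denotes `1#` itself.
  fromℤ : ℤ → Carrier
  fromℤ (+ k)    = k · 1#
  fromℤ -[1+ k ] = - (suc k · 1#)

  suc·1 : ∀ k → suc k · 1# ≈ 1# + k · 1#
  suc·1 = ×-homo-+ 1# 1

  cancel-common : ∀ x y z → (x + y) - (x + z) ≈ y - z
  cancel-common x y z = begin
    (x + y) - (x + z)      ≈⟨ +-cong (+-comm x y) (-‿anti-homo-+ x z) ⟩
    (y + x) + (- z - x)    ≈⟨ +-congˡ (+-comm (- z) (- x)) ⟩
    (y + x) + (- x - z)    ≈⟨ +-assoc y x _ ⟩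
    y + (x + (- x - z))    ≈⟨ +-congˡ (+-assoc x (- x) (- z)) ⟨
    y + ((x - x) - z)      ≈⟨ +-congˡ (+-congʳ (-‿inverseʳ x)) ⟩
    y + (0# - z)           ≈⟨ +-congˡ (+-identityˡ (- z)) ⟩
    y - z                  ∎

  fromℤ-⊖ : ∀ j k → fromℤ (j ⊖ k) ≈ j · 1# - k · 1#
  fromℤ-⊖ zero    zero    = sym (-‿inverseʳ 0#)
  fromℤ-⊖ zero    (suc k) = sym (+-identityˡ _)
  fromℤ-⊖ (suc j) zero    = sym (trans (+-congˡ -0#≈0#) (+-identityʳ _))
  fromℤ-⊖ (suc j) (suc k) = begin
    fromℤ (suc j ⊖ suc k)              ≡⟨ ≡.cong fromℤ (ℤₚ.[1+m]⊖[1+n]≡m⊖n j k) ⟩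
    fromℤ (j ⊖ k)                      ≈⟨ fromℤ-⊖ j k ⟩
    j · 1# - k · 1#                    ≈⟨ cancel-common 1# _ _ ⟨
    (1# + j · 1#) - (1# + k · 1#)      ≈⟨ +-cong (suc·1 j) (-‿cong (suc·1 k)) ⟨
    suc j · 1# - suc k · 1#            ∎

  fromℤ-neg : ∀ i → fromℤ (ℤ.- i) ≈ - fromℤ i
  fromℤ-neg (+ zero)  = sym -0#≈0#
  fromℤ-neg (+ suc k) = refl
  fromℤ-neg -[1+ k ]  = sym (-‿involutive _)

  fromℤ-+ : ∀ i j → fromℤ (i ℤ.+ j) ≈ fromℤ i + fromℤ j
  fromℤ-+ (+ j)    (+ k)    = ×-homo-+ 1# j k
  fromℤ-+ (+ j)    -[1+ k ] = fromℤ-⊖ j (suc k)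
  fromℤ-+ -[1+ j ] (+ k)    = trans (fromℤ-⊖ k (suc j)) (+-comm _ _)
  fromℤ-+ -[1+ j ] -[1+ k ] = begin
    - (suc (suc (j ℕ.+ k)) · 1#)        ≡⟨ ≡.cong (λ i → - (suc i · 1#)) (ℕₚ.+-suc j k) ⟨
    - ((suc j ℕ.+ suc k) · 1#)          ≈⟨ -‿cong (×-homo-+ 1# (suc j) (suc k)) ⟩
    - (suc j · 1# + suc k · 1#)         ≈⟨ -‿+-comm _ _ ⟨
    - (suc j · 1#) - suc k · 1#         ∎

  fromℤ-◃⁻ : ∀ k → fromℤ (Sign.- ◃ k) ≈ - (k · 1#)
  fromℤ-◃⁻ zero    = sym -0#≈0#
  fromℤ-◃⁻ (suc k) = refl

  fromℤ-◃⁺ : ∀ k → fromℤ (Sign.+ ◃ k) ≈ k · 1#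
  fromℤ-◃⁺ zero    = refl
  fromℤ-◃⁺ (suc k) = refl

  fromℤ-* : ∀ i j → fromℤ (i ℤ.* j) ≈ fromℤ i * fromℤ j
  fromℤ-* (+ j)    (+ k)    = trans (fromℤ-◃⁺ (j ℕ.* k)) (×1-homo-* j k)
  fromℤ-* (+ j)    -[1+ k ] = begin
    fromℤ (Sign.- ◃ (j ℕ.* suc k))      ≈⟨ fromℤ-◃⁻ (j ℕ.* suc k) ⟩
    - ((j ℕ.* suc k) · 1#)              ≈⟨ -‿cong (×1-homo-* j (suc k)) ⟩
    - (j · 1# * (suc k · 1#))           ≈⟨ -‿distribʳ-* _ _ ⟩
    j · 1# * - (suc k · 1#)             ∎
  fromℤ-* -[1+ j ] (+ k)    = begin
    fromℤ (Sign.- ◃ (suc j ℕ.* k))      ≈⟨ fromℤ-◃⁻ (suc j ℕ.* k) ⟩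
    - ((suc j ℕ.* k) · 1#)              ≈⟨ -‿cong (×1-homo-* (suc j) k) ⟩
    - (suc j · 1# * (k · 1#))           ≈⟨ -‿distribˡ-* _ _ ⟩
    - (suc j · 1#) * (k · 1#)           ∎
  fromℤ-* -[1+ j ] -[1+ k ] = begin
    (suc j ℕ.* suc k) · 1#              ≈⟨ ×1-homo-* (suc j) (suc k) ⟩
    suc j · 1# * (suc k · 1#)           ≈⟨ -‿involutive _ ⟨
    - - (suc j · 1# * (suc k · 1#))     ≈⟨ -‿cong (-‿distribˡ-* _ _) ⟩
    - (- (suc j · 1#) * (suc k · 1#))   ≈⟨ -‿distribʳ-* _ _ ⟩
    - (suc j · 1#) * - (suc k · 1#)     ∎

  fromℤ-morphism : ℤ.+-*-rawRing -Raw-AlmostCommutative⟶ fromCommutativeRing A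
  fromℤ-morphism = record
    { ⟦_⟧    = fromℤ
    ; +-homo = fromℤ-+
    ; *-homo = fromℤ-*
    ; -‿homo = fromℤ-neg
    ; 0-homo = refl
    ; 1-homo = refl
    }

  open RingSolver ℤ.+-*-rawRing (fromCommutativeRing A) fromℤ-morphism
    (λ i j → Maybe.map (λ i≡j → reflexive (≡.cong fromℤ i≡j)) (dec⇒maybe (i ℤₚ.≟ j)))
    public using (Polynomial; solve; con; _:+_; _:*_; _:-_; :-_; _:=_)

  -- `:2` is spelled as the normal form of `fromℕ 2`, just as `:1 :+ K` matches `fromℕ (suc k)`;
  -- solved equations then agree with their goals definitionally.
  :0 :1 :2 : ∀ {m} → Polynomial m
  :0 = con 0ℤ
  :1 = con 1ℤ
  :2 = :1 :+ (:1 :+ :0)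

-- Constructive order arithmetic.

module RealProperties {c ℓ₁ ℓ₂ ℓ₃ : Level} (R : RealNumbers c ℓ₁ ℓ₂ ℓ₃) where
  open RealNumbers R
  open ℤ-CoefficientSolver commutativeRing public
  private module Mult = SemiringMult (CommutativeRing.semiring commutativeRing)

  #⇒<⊎> : ∀ {x y} → x # y → x < y ⊎ y < x
  #⇒<⊎> = Equivalence.to (#⇔<⊎> _ _)

  0<⇒#0 : ∀ {x} → 0# < x → x # 0#
  0<⇒#0 0<x = Equivalence.from (#⇔<⊎> _ _) (inj₂ 0<x)

  <-cotrans : ∀ {x y} → x < y → ∀ z → x < z ⊎ z < y
  <-cotrans {x} {y} x<y z with #-cotrans (Equivalence.from (#⇔<⊎> x y) (inj₁ x<y)) z
  ... | inj₁ x#z with #⇒<⊎> x#z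
  ...   | inj₁ x<z = inj₁ x<z
  ...   | inj₂ z<x = inj₂ (<.trans z<x x<y)
  <-cotrans {x} {y} x<y z | inj₂ z#y with #⇒<⊎> z#y
  ...   | inj₁ z<y = inj₂ z<y
  ...   | inj₂ y<z = inj₁ (<.trans x<y y<z)

  <-resp₂-≈ : ∀ {x x′ y y′} → x ≈ x′ → y ≈ y′ → x < y → x′ < y′
  <-resp₂-≈ x≈x′ y≈y′ x<y = <.<-respʳ-≈ y≈y′ (<.<-respˡ-≈ x≈x′ x<y)

  ≤-respʳ-≈ : ∀ {x y z} → y ≈ z → x ≤ y → x ≤ z
  ≤-respʳ-≈ y≈z x≤y z<x = x≤y (<.<-respˡ-≈ (sym y≈z) z<x)

  <⇒≤ : ∀ {x y} → x < y → x ≤ y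
  <⇒≤ = <.asym

  ≤-refl : ∀ {x} → x ≤ x
  ≤-refl = <.irrefl refl

  ≤-<-trans : ∀ {x y z} → x ≤ y → y < z → x < z
  ≤-<-trans {x} x≤y y<z with <-cotrans y<z x
  ... | inj₁ y<x = contradiction y<x x≤y
  ... | inj₂ x<z = x<z

  -- _<_ is not decidable, but a negation, such as an instance of _≤_, can be
  -- proved by cases on it.
  <⊎≥-elim-¬ : ∀ {x y p} {P : Set p} → (x < y → ¬ P) → (y ≤ x → ¬ P) → ¬ P
  <⊎≥-elim-¬ if< if≥ p = if≥ (λ x<y → if< x<y p) p

  -- Tightness of apartness: once `x < 0#` and `0# < x` are both refuted, `x ≈ 0#` remains. Two
  -- cases therefore suffice for a negated goal.
  0≤-elim-¬ : ∀ {x p} {P : Set p} → 0# ≤ x → (0# < x → ¬ P) → (x ≈ 0# → ¬ P) → ¬ P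
  0≤-elim-¬ {x} 0≤x if> if≈ p = if≈ (proj₁ (tight x 0#) ¬x#0) p
    where
    ¬x#0 : ¬ (x # 0#)
    ¬x#0 x#0 with #⇒<⊎> x#0
    ... | inj₁ x<0 = 0≤x x<0
    ... | inj₂ 0<x = if> 0<x p

  x<y⇒0<y-x : ∀ {x y} → x < y → 0# < y - x
  x<y⇒0<y-x {x} x<y = <.<-respˡ-≈ (-‿inverseʳ x) (+-monoˡ-< (- x) x<y)

  0<y-x⇒x<y : ∀ {x y} → 0# < y - x → x < y
  0<y-x⇒x<y {x} {y} 0<y-x = <-resp₂-≈ (+-identityˡ x)
    (solve 2 (λ x y → y :- x :+ x := y) refl x y) (+-monoˡ-< x 0<y-x)

  0≤y-x⇒x≤y : ∀ {x y} → 0# ≤ y - x → x ≤ y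
  0≤y-x⇒x≤y {x} 0≤y-x y<x = 0≤y-x (<.<-respʳ-≈ (-‿inverseʳ x) (+-monoˡ-< (- x) y<x))

  x<0⇒0<-x : ∀ {x} → x < 0# → 0# < - x
  x<0⇒0<-x {x} x<0 = <.<-respʳ-≈ (+-identityˡ (- x)) (x<y⇒0<y-x x<0)

  0<-x⇒x<0 : ∀ {x} → 0# < - x → x < 0#
  0<-x⇒x<0 {x} 0<-x = 0<y-x⇒x<y (<.<-respʳ-≈ (sym (+-identityˡ (- x))) 0<-x)

  pos+nonneg : ∀ {x y} → 0# < x → 0# ≤ y → 0# < x + y
  pos+nonneg {x} {y} 0<x 0≤y = ≤-<-trans 0≤y (<.<-respˡ-≈ (+-identityˡ y) (+-monoˡ-< y 0<x))

  +-nonneg : ∀ {x y} → 0# ≤ x → 0# ≤ y → 0# ≤ x + y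
  +-nonneg {x} {y} 0≤x 0≤y x+y<0 = 0≤x (0<-x⇒x<0 (<.<-respʳ-≈
    (solve 2 (λ x y → :- (x :+ y) :+ y := :- x) refl x y)
    (pos+nonneg (x<0⇒0<-x x+y<0) 0≤y)))

  *-nonneg : ∀ {x y} → 0# ≤ x → 0# ≤ y → 0# ≤ x * y
  *-nonneg 0≤x 0≤y = 0≤-elim-¬ 0≤x
    (λ 0<x → 0≤-elim-¬ 0≤y
      (λ 0<y → <.asym (*-pos 0<x 0<y))
      (λ y≈0 → <.irrefl (trans (*-congˡ y≈0) (zeroʳ _))))
    (λ x≈0 → <.irrefl (trans (*-congʳ x≈0) (zeroˡ _)))

  *-cancel-nonneg : ∀ {x y} → 0# < x → 0# ≤ x * y → 0# ≤ y
  *-cancel-nonneg {x} {y} 0<x 0≤xy y<0 = 0≤xy (0<-x⇒x<0 (<.<-respʳ-≈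
    (solve 2 (λ x y → x :* (:- y) := :- (x :* y)) refl x y) (*-pos 0<x (x<0⇒0<-x y<0))))

  *-recip : ∀ x (x#0 : x # 0#) → x * recip x x#0 ≈ 1#
  *-recip x x#0 = trans (solve 2 (λ x y → x :* y := y :* (x :- :0)) refl x _)
    (proj₁ (proj₂ (#⇒invertible x#0)))

  -- A reciprocal is itself invertible, hence apart from zero; a negative `r` would make
  -- `x * (- r)`, which is `- 1#`, positive.
  recip-pos : ∀ {x} (x#0 : x # 0#) → 0# < x → 0# < recip x x#0
  recip-pos {x} x#0 0<x with #⇒<⊎> (invertible⇒# {recip x x#0} {0#} (x , inverse′ , inverse″))
    where
    inverse′ : x * (recip x x#0 - 0#) ≈ 1#
    inverse′ = trans (solve 2 (λ x y → x :* (y :- :0) := x :* y) refl x _) (*-recip x x#0)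
    inverse″ : (recip x x#0 - 0#) * x ≈ 1#
    inverse″ = trans (*-comm _ x) inverse′
  ... | inj₂ 0<r = 0<r
  ... | inj₁ r<0 = contradiction 0<1 (<.asym (0<-x⇒x<0 (<.<-respʳ-≈
    (trans (solve 2 (λ x y → x :* (:- y) := :- (x :* y)) refl x _) (-‿cong (*-recip x x#0)))
    (*-pos 0<x (x<0⇒0<-x r<0)))))

  *-cancel-pos : ∀ {x y} → 0# < x → 0# < x * y → 0# < y
  *-cancel-pos {x} {y} 0<x 0<xy = <.<-respʳ-≈ r[xy]≈y (*-pos (recip-pos x#0 0<x) 0<xy)
    where
    x#0 : x # 0#
    x#0 = 0<⇒#0 0<x
    r[xy]≈y : recip x x#0 * (x * y) ≈ y
    r[xy]≈y = trans (solve 3 (λ r x y → r :* (x :* y) := (x :* r) :* y) refl _ x y)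
      (trans (*-congʳ (*-recip x x#0)) (*-identityˡ y))

  ÷-cancel : ∀ x k .{{_ : NonZero k}} → fromℕ k * (x ÷ k) ≈ x
  ÷-cancel x k = trans (solve 3 (λ x k r → k :* (x :* r) := (k :* r) :* x) refl x (fromℕ k) _)
    (trans (*-congʳ (*-recip (fromℕ k) _)) (*-identityˡ x))

  0≤fromℕ : ∀ k → 0# ≤ fromℕ k
  0≤fromℕ zero    = ≤-refl
  0≤fromℕ (suc k) = <⇒≤ (0<fromℕ k)

  fromℕ-+ : ∀ j k → fromℕ (j ℕ.+ k) ≈ fromℕ j + fromℕ k
  fromℕ-+ = Mult.×-homo-+ 1#

  fromℕ-* : ∀ j k → fromℕ (j ℕ.* k) ≈ fromℕ j * fromℕ k
  fromℕ-* = Mult.×1-homo-*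

  fromℕ-mono-≤ : ∀ {j k} → j ℕ.≤ k → 0# ≤ fromℕ k - fromℕ j
  fromℕ-mono-≤ {k = k} z≤n = ≤-respʳ-≈ (solve 1 (λ k → k := k :- :0) refl (fromℕ k)) (0≤fromℕ k)
  fromℕ-mono-≤ {suc j} {suc k} (s≤s j≤k) = ≤-respʳ-≈
    (solve 2 (λ j k → k :- j := (:1 :+ k) :- (:1 :+ j)) refl (fromℕ j) (fromℕ k))
    (fromℕ-mono-≤ j≤k)

-- Inequalities for sequences obeying the Gegenbauer recurrences.

module GegenbauerInequality {ℓ₀ ℓ₁ ℓ₂ ℓ₃ : Level} (R : RealNumbers ℓ₀ ℓ₁ ℓ₂ ℓ₃) where
  open RealNumbers R
  open RealProperties R
  open SetoidReasoning setoid

  module Recurrence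
    (n : ℕ) (x : Carrier) (c e : ℕ → Carrier)
    (c-zero : c 0 ≈ 1#) (e-zero : e 0 ≈ 0#)
    (e-suc : ∀ k → e (suc k) ≈ x * e k + (fromℕ k + fromℕ 2 * fromℕ (suc n)) * c k)
    (c-suc : ∀ k → fromℕ (suc k) * c (suc k) ≈ x * e (suc k) - e k)
    where

    N : Carrier
    N = fromℕ n

    -- (k + 2n + 1) c (k - 1)
    h : ℕ → Carrier
    h k = (1# - x * x) * e k + x * (fromℕ k * c k)

    h-zero : h 0 ≈ 0#
    h-zero = begin
      (1# - x * x) * e 0 + x * (0# * c 0)    ≈⟨ +-congʳ (*-congˡ e-zero) ⟩
      (1# - x * x) * 0# + x * (0# * c 0)     ≈⟨ solve 2 (λ x c →
        (:1 :- x :* x) :* :0 :+ x :* (:0 :* c) := :0) refl x (c 0) ⟩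
      0#                                     ∎

    -- Eliminating `c (suc k)` by `c-suc` cancels the terms in x², and `e-suc` evaluates the
    -- remaining difference. The factor k + 2a is (k + 1) + 2n + 1.
    h-suc : ∀ k → h (suc k) ≈ (fromℕ k + fromℕ 2 * fromℕ (suc n)) * c k
    h-suc k = begin
      (1# - x * x) * e (suc k) + x * (fromℕ (suc k) * c (suc k))
        ≈⟨ +-congˡ (*-congˡ (c-suc k)) ⟩
      (1# - x * x) * e (suc k) + x * (x * e (suc k) - e k)
        ≈⟨ solve 3 (λ x e e′ → (:1 :- x :* x) :* e′ :+ x :* (x :* e′ :- e)
                              := e′ :- x :* e) refl x (e k) (e (suc k)) ⟩
      e (suc k) - x * e k
        ≈⟨ +-congʳ (e-suc k) ⟩
      x * e k + (fromℕ k + fromℕ 2 * fromℕ (suc n)) * c k - x * e k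
        ≈⟨ solve 2 (λ u v → u :+ v :- u := v) refl _ _ ⟩
      (fromℕ k + fromℕ 2 * fromℕ (suc n)) * c k ∎

    -- The classical three-term recurrence. Writing its last term as `h k` instead of (k + 2n + 1) c
    -- (k - 1) keeps it valid at k = 0.
    c-suc′ : ∀ k → fromℕ (suc k) * c (suc k) ≈ fromℕ 2 * (fromℕ (suc k) + N) * x * c k - h k
    c-suc′ k = begin
      fromℕ (suc k) * c (suc k)
        ≈⟨ c-suc k ⟩
      x * e (suc k) - e k
        ≈⟨ +-congʳ (*-congˡ (e-suc k)) ⟩
      x * (x * e k + (fromℕ k + fromℕ 2 * fromℕ (suc n)) * c k) - e k
        ≈⟨ solve 5 (λ N K x c e →
             x :* (x :* e :+ (K :+ :2 :* (:1 :+ N)) :* c) :- e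
               := :2 :* (:1 :+ K :+ N) :* x :* c :- ((:1 :- x :* x) :* e :+ x :* (K :* c)))
             refl N (fromℕ k) x (c k) (e k) ⟩
      fromℕ 2 * (fromℕ (suc k) + N) * x * c k - h k ∎

    -- A quarter of the discriminant of k ρ² - 2 (k + n) x ρ + (k + 2n).
    discriminant : ℕ → Carrier
    discriminant k = (N + fromℕ k) * x * ((N + fromℕ k) * x) - fromℕ k * (fromℕ k + fromℕ 2 * N)

    F : Carrier → ℕ → Carrier
    F t k = fromℕ k * ((x * x - 1#) * (t * t) - 1#) + fromℕ 2 * N * (x * t - 1#)

    -- With D = d and B = (n + d) x, the ratios c k / c (k - 1) for k ≤ d are
    -- bounded below by B / D.  The vertex B / D of the quadratic
    -- k ρ² - 2 (k + n) x ρ + (k + 2n) makes it nonpositive when k = d.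
    module Positivity
      (d-1 : ℕ) (0<x : 0# < x) (B²≥D[D+2N] : 0# ≤ discriminant (suc d-1))
      where

      d : ℕ
      d = suc d-1

      D B : Carrier
      D = fromℕ d
      B = (N + D) * x

      0<D : 0# < D
      0<D = 0<fromℕ d-1

      0<N+D : 0# < N + D
      0<N+D = <.<-respʳ-≈ (+-comm D N) (pos+nonneg 0<D (0≤fromℕ n))

      0<B : 0# < B
      0<B = *-pos 0<N+D 0<x

      -- Being affine in K, it only has to be bounded at 0 and D.
      q : Carrier → Carrier
      q K = fromℕ 2 * (K + N) * x * D * B - (K + fromℕ 2 * N) * D * D - K * B * B

      -- Multiplied by `N + D`, the difference becomes the discriminant at `d` plus the surplus
      -- `D * N`, because `(N + D) * x` is `B`.
      xB≥D : 0# ≤ x * B - D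
      xB≥D = *-cancel-nonneg 0<N+D (≤-respʳ-≈
        (solve 3 (λ x N D → let B = (N :+ D) :* x in
            (B :* B :- D :* (D :+ :2 :* N)) :+ D :* N
              := (N :+ D) :* (x :* B :- D)) refl x N D)
        (+-nonneg B²≥D[D+2N] (*-nonneg (<⇒≤ 0<D) (0≤fromℕ n))))

      -- `q K` is -D² times the quadratic at ρ = B / D. Affinity gives D q(K) = K q(D) + (D - K)
      -- q(0), where q(D) = D (B² - D (D + 2N)) and q(0) = 2 N D (x B - D).
      q-nonneg : ∀ {k} → k ℕ.≤ d → 0# ≤ q (fromℕ k)
      q-nonneg {k} k≤d = *-cancel-nonneg 0<D (≤-respʳ-≈
        (solve 4 (λ x N D K → let B = (N :+ D) :* x in
            K :* (D :* (B :* B :- D :* (D :+ :2 :* N)))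
              :+ (D :- K) :* (:2 :* (N :* D) :* (x :* B :- D))
              := D :* (:2 :* (K :+ N) :* x :* D :* B :- (K :+ :2 :* N) :* D :* D :- K :* B :* B))
          refl x N D (fromℕ k))
        (+-nonneg
          (*-nonneg (0≤fromℕ k) (*-nonneg (<⇒≤ 0<D) B²≥D[D+2N]))
          (*-nonneg (fromℕ-mono-≤ k≤d)
            (*-nonneg (*-nonneg (0≤fromℕ 2) (*-nonneg (0≤fromℕ n) (<⇒≤ 0<D))) xB≥D))))

      -- The second component is (k + 2n + 1) (D c k - B c (k - 1)), the ratio bound times a
      -- positive factor. Phrasing it through `h` gives it a meaning at k = 0, where `h 0` vanishes.
      Invariant : ℕ → Set ℓ₃
      Invariant k = 0# < c k ×
        0# ≤ (fromℕ k + fromℕ 2 * N + 1#) * (D * c k) - B * h k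

      -- The invariant bounds `h k` from above in `c-suc′`. What then remains of the ratio bound for
      -- k + 1, after clearing denominators, is `c k * q (fromℕ (suc k))`.
      ratio-step : ∀ {k} → k ℕ.< d → Invariant k → 0# ≤ D * c (suc k) - B * c k
      ratio-step {k} k<d (0<c , 0≤i) =
        *-cancel-nonneg (0<fromℕ k) (*-cancel-nonneg 0<B (≤-respʳ-≈ identity
          (+-nonneg (*-nonneg (<⇒≤ 0<D) 0≤i) (*-nonneg (<⇒≤ 0<c) (q-nonneg k<d)))))
        where
        identity :
          D * ((fromℕ k + fromℕ 2 * N + 1#) * (D * c k) - B * h k) + c k * q (fromℕ (suc k))
          ≈ B * (fromℕ (suc k) * (D * c (suc k) - B * c k))
        identity = begin
          D * ((fromℕ k + fromℕ 2 * N + 1#) * (D * c k) - B * h k) + c k * q (fromℕ (suc k))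
            ≈⟨ solve 7 (λ x N D K c h B →
                 D :* ((K :+ :2 :* N :+ :1) :* (D :* c) :- B :* h)
                   :+ c :* (:2 :* (:1 :+ K :+ N) :* x :* D :* B
                            :- (:1 :+ K :+ :2 :* N) :* D :* D :- (:1 :+ K) :* B :* B)
                   := B :* (D :* (:2 :* (:1 :+ K :+ N) :* x :* c :- h) :- (:1 :+ K) :* (B :* c)))
                 refl x N D (fromℕ k) (c k) (h k) B ⟩
          B * (D * (fromℕ 2 * (fromℕ (suc k) + N) * x * c k - h k) - fromℕ (suc k) * (B * c k))
            ≈⟨ *-congˡ (+-congʳ (*-congˡ (c-suc′ k))) ⟨
          B * (D * (fromℕ (suc k) * c (suc k)) - fromℕ (suc k) * (B * c k))
            ≈⟨ solve 5 (λ D K B c c′ → B :* (D :* (K :* c′) :- K :* (B :* c))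
                                      := B :* (K :* (D :* c′ :- B :* c)))
                 refl D (fromℕ (suc k)) B (c k) (c (suc k)) ⟩
          B * (fromℕ (suc k) * (D * c (suc k) - B * c k)) ∎

      invariant : ∀ {k} → k ℕ.≤ d → Invariant k
      invariant {zero} _ =
        <.<-respʳ-≈ (sym c-zero) 0<1 ,
        ≤-respʳ-≈ (begin
          (fromℕ 2 * N + 1#) * D
            ≈⟨ solve 3 (λ N D B → (:2 :* N :+ :1) :* D
                                 := (:0 :+ :2 :* N :+ :1) :* (D :* :1) :- B :* :0) refl N D B ⟩
          (0# + fromℕ 2 * N + 1#) * (D * 1#) - B * 0#
            ≈⟨ +-cong (*-congˡ (*-congˡ c-zero)) (-‿cong (*-congˡ h-zero)) ⟨
          (0# + fromℕ 2 * N + 1#) * (D * c 0) - B * h 0 ∎)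
        (*-nonneg (+-nonneg (*-nonneg (0≤fromℕ 2) (0≤fromℕ n)) (<⇒≤ 0<1)) (<⇒≤ 0<D))
      invariant {suc k} k<d with invariant (ℕₚ.<⇒≤ k<d)
      ... | inv@(0<c , _) =
        *-cancel-pos 0<D (<.<-respʳ-≈
          (solve 2 (λ u v → u :+ (v :- u) := v) refl _ _)
          (pos+nonneg (*-pos 0<B 0<c) 0≤step)) ,
        -- The ratio bound just obtained is multiplied by the factor k + 2a that `h-suc` attaches to
        -- `c k`.
        ≤-respʳ-≈ (begin
          (fromℕ k + fromℕ 2 * fromℕ (suc n)) * (D * c (suc k) - B * c k)
            ≈⟨ solve 6 (λ N K D B c c′ → let a = K :+ :2 :* (:1 :+ N) in
                 a :* (D :* c′ :- B :* c)
                   := (:1 :+ K :+ :2 :* N :+ :1) :* (D :* c′) :- B :* (a :* c))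
                 refl N (fromℕ k) D B (c k) (c (suc k)) ⟩
          (fromℕ (suc k) + fromℕ 2 * N + 1#) * (D * c (suc k))
            - B * ((fromℕ k + fromℕ 2 * fromℕ (suc n)) * c k)
            ≈⟨ +-congˡ (-‿cong (*-congˡ (h-suc k))) ⟨
          (fromℕ (suc k) + fromℕ 2 * N + 1#) * (D * c (suc k)) - B * h (suc k) ∎)
        (*-nonneg (+-nonneg (0≤fromℕ k) (*-nonneg (0≤fromℕ 2) (0≤fromℕ (suc n)))) 0≤step)
        where
        0≤step : 0# ≤ D * c (suc k) - B * c k
        0≤step = ratio-step k<d inv

      c-pos : ∀ {k} → k ℕ.≤ d → 0# < c k
      c-pos k≤d = proj₁ (invariant k≤d)

    e-nonneg : ∀ {k} → 0# ≤ x → (∀ {j} → j ℕ.< k → 0# ≤ c j) → 0# ≤ e k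
    e-nonneg {zero}  0≤x 0≤c = ≤-respʳ-≈ (sym e-zero) ≤-refl
    e-nonneg {suc k} 0≤x 0≤c = ≤-respʳ-≈ (sym (e-suc k)) (+-nonneg
      (*-nonneg 0≤x (e-nonneg 0≤x λ j<k → 0≤c (ℕₚ.m<n⇒m<1+n j<k)))
      (*-nonneg (+-nonneg (0≤fromℕ k) (*-nonneg (0≤fromℕ 2) (0≤fromℕ (suc n)))) (0≤c ℕₚ.≤-refl)))

    module DerivativeBound
      (d-1 : ℕ) (t : Carrier) (0<x : 0# < x) (0<t : 0# < t) (F≥0 : 0# ≤ F t (suc d-1))
      (0≤c : ∀ {k} → k ℕ.≤ suc d-1 → 0# ≤ c k)
      where

      d : ℕ
      d = suc d-1

      D : Carrier
      D = fromℕ d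

      0<D : 0# < D
      0<D = 0<fromℕ d-1

      -- With w = x t - 1, `F t d` equals w (D (x t + 1) + 2N) - D t², which is negative as soon as
      -- w is.
      xt≥1 : 0# ≤ x * t - 1#
      xt≥1 xt<1 = F≥0 (0<-x⇒x<0 (<.<-respʳ-≈
        (solve 4 (λ x t N D → let w = x :* t :- :1 in
            D :* (t :* t) :+ (:- w) :* (D :* (x :* t :+ :1) :+ :2 :* N)
              := :- (D :* ((x :* x :- :1) :* (t :* t) :- :1) :+ :2 :* N :* w))
          refl x t N D)
        (pos+nonneg (*-pos 0<D (*-pos 0<t 0<t))
          (*-nonneg (<⇒≤ (x<0⇒0<-x xt<1))
            (+-nonneg
              (*-nonneg (<⇒≤ 0<D) (+-nonneg (<⇒≤ (*-pos 0<x 0<t)) (<⇒≤ 0<1)))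
              (*-nonneg (0≤fromℕ 2) (0≤fromℕ n)))))))

      -- Affine interpolation between 0 and `d`, multiplied by `D` to avoid a division.
      F-nonneg : ∀ {k} → k ℕ.≤ d → 0# ≤ F t k
      F-nonneg {k} k≤d = *-cancel-nonneg 0<D (≤-respʳ-≈
        (solve 5 (λ x t N D K → let u = (x :* x :- :1) :* (t :* t) :- :1
                                    v = :2 :* N :* (x :* t :- :1) in
            K :* (D :* u :+ v) :+ (D :- K) :* v := D :* (K :* u :+ v))
          refl x t N D (fromℕ k))
        (+-nonneg (*-nonneg (0≤fromℕ k) F≥0)
          (*-nonneg (fromℕ-mono-≤ k≤d) (*-nonneg (*-nonneg (0≤fromℕ 2) (0≤fromℕ n)) xt≥1))))

      e≤ktc : ∀ {k} → k ℕ.≤ d → 0# ≤ fromℕ k * t * c k - e k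
      e≤ktc {zero} _ = ≤-respʳ-≈ (begin
        0#                     ≈⟨ solve 2 (λ t c → :0 := :0 :* t :* c :- :0) refl t (c 0) ⟩
        0# * t * c 0 - 0#      ≈⟨ +-congˡ (-‿cong e-zero) ⟨
        0# * t * c 0 - e 0     ∎) ≤-refl
      -- The sign of ε cannot be decided, but the goal is a negation, which permits the case split.
      e≤ktc {suc k} k<d = <⊎≥-elim-¬
        -- Multiplying the induction hypothesis by - ε replaces ε e k by ε k t c k; the coefficient
        -- of `c k` is then k t ε + w (k + 2a) = F k + 2w.
        (λ ε<0 → ≤-respʳ-≈ (trans
          (solve 6 (λ x t N K c e → let w = x :* t :- :1; ε = w :* x :- t in
              (:- ε) :* (K :* t :* c :- e)
                :+ (K :* ((x :* x :- :1) :* (t :* t) :- :1) :+ :2 :* N :* w :+ :2 :* w) :* c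
                := ε :* e :+ w :* (K :+ :2 :* (:1 :+ N)) :* c)
            refl x t N (fromℕ k) (c k) (e k)) (sym identity))
          (+-nonneg (*-nonneg (<⇒≤ (x<0⇒0<-x ε<0)) (e≤ktc k≤d))
            (*-nonneg (+-nonneg (F-nonneg k≤d) (*-nonneg (0≤fromℕ 2) xt≥1)) (0≤c k≤d))))
        (λ 0≤ε → ≤-respʳ-≈ (sym identity)
          (+-nonneg
            (*-nonneg 0≤ε (e-nonneg (<⇒≤ 0<x) λ j<k → 0≤c (ℕₚ.≤-trans (ℕₚ.<⇒≤ j<k) k≤d)))
            (*-nonneg
              (*-nonneg xt≥1 (+-nonneg (0≤fromℕ k) (*-nonneg (0≤fromℕ 2) (0≤fromℕ (suc n)))))
              (0≤c k≤d))))
        where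
        k≤d : k ℕ.≤ d
        k≤d = ℕₚ.<⇒≤ k<d

        w ε : Carrier
        w = x * t - 1#
        ε = w * x - t

        identity : fromℕ (suc k) * t * c (suc k) - e (suc k)
          ≈ ε * e k + w * (fromℕ k + fromℕ 2 * fromℕ (suc n)) * c k
        identity = begin
          fromℕ (suc k) * t * c (suc k) - e (suc k)
            ≈⟨ solve 4 (λ K t c e → K :* t :* c :- e := t :* (K :* c) :- e) refl _ t _ _ ⟩
          t * (fromℕ (suc k) * c (suc k)) - e (suc k)
            ≈⟨ +-congʳ (*-congˡ (c-suc k)) ⟩
          t * (x * e (suc k) - e k) - e (suc k)
            ≈⟨ solve 4 (λ x t e e′ → t :* (x :* e′ :- e) :- e′ := (x :* t :- :1) :* e′ :- t :* e)
                 refl x t (e k) (e (suc k)) ⟩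
          w * e (suc k) - t * e k
            ≈⟨ +-congʳ (*-congˡ (e-suc k)) ⟩
          w * (x * e k + (fromℕ k + fromℕ 2 * fromℕ (suc n)) * c k) - t * e k
            ≈⟨ solve 6 (λ w x t e a c → w :* (x :* e :+ a :* c) :- t :* e
                                       := (w :* x :- t) :* e :+ w :* a :* c)
                 refl w x t (e k) _ (c k) ⟩
          ε * e k + w * (fromℕ k + fromℕ 2 * fromℕ (suc n)) * c k ∎

-- Finite sums and shifted coefficient sequences.

module Sums {ℓ₀ ℓ₁ ℓ₂ ℓ₃ : Level} (R : RealNumbers ℓ₀ ℓ₁ ℓ₂ ℓ₃) where
  open RealNumbers R
  open RealProperties R
  open SetoidReasoning setoid

  ∑[k<_]_ : ℕ → (ℕ → Carrier) → Carrier
  ∑[k< zero  ] v = 0#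
  ∑[k< suc m ] v = ∑[k< m ] v + v m

  ∑-front : ∀ m v → ∑[k< suc m ] v ≈ v 0 + ∑[k< m ] (λ k → v (suc k))
  ∑-front zero    v = +-comm _ _
  ∑-front (suc m) v = trans (+-congʳ (∑-front m v)) (+-assoc _ _ _)

  ∑-zero : ∀ m {v} → (∀ k → k ℕ.< m → v k ≈ 0#) → ∑[k< m ] v ≈ 0#
  ∑-zero zero    v≈0 = refl
  ∑-zero (suc m) v≈0 = trans
    (+-cong (∑-zero m λ k k<m → v≈0 k (ℕₚ.m<n⇒m<1+n k<m)) (v≈0 m ℕₚ.≤-refl)) (+-identityʳ 0#)

  -- Brings sums truncated at different orders to a common length, so that they can be combined
  -- termwise.
  ∑-extend : ∀ j m {v} → (∀ k → m ℕ.≤ k → v k ≈ 0#) → ∑[k< j ℕ.+ m ] v ≈ ∑[k< m ] v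
  ∑-extend zero    m v≈0 = refl
  ∑-extend (suc j) m v≈0 = trans
    (+-cong (∑-extend j m v≈0) (v≈0 (j ℕ.+ m) (ℕₚ.m≤n+m m j))) (+-identityʳ _)

  -- Multiplication of a power series by t.
  shift : (ℕ → Carrier) → ℕ → Carrier
  shift v zero    = 0#
  shift v (suc m) = v m

  shift-cong : ∀ {v w} → (∀ m → v m ≈ w m) → ∀ m → shift v m ≈ shift w m
  shift-cong v≈w zero    = refl
  shift-cong v≈w (suc m) = v≈w m

  shift-linear : ∀ a b v w m → shift (λ i → a * v i + b * w i) m ≈ a * shift v m + b * shift w m
  shift-linear a b v w zero    = solve 2 (λ a b → :0 := a :* :0 :+ b :* :0) refl a b
  shift-linear a b v w (suc m) = refl

-- Linear functionals of polynomials and the powers of u = - 2 x t + t².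

module PolynomialFunctionals {ℓ₀ ℓ₁ ℓ₂ ℓ₃ : Level} (R : RealNumbers ℓ₀ ℓ₁ ℓ₂ ℓ₃) where
  open RealNumbers R
  open RealProperties R
  open Gegenbauer R
  open Sums R
  open SetoidReasoning setoid

  -- The last condition expresses that φ ignores trailing zeros.
  record IsLinear (φ : Poly → Carrier) : Set (ℓ₀ ⊔ ℓ₁) where
    field
      φ-[]    : φ [] ≈ 0#
      φ-⊕     : ∀ p q → φ (p ⊕ q) ≈ φ p + φ q
      φ-scale : ∀ a p → φ (scale a p) ≈ a * φ p
      φ-0∷[]  : φ (0# ∷ []) ≈ 0#

  zero-linear : IsLinear (λ _ → 0#)
  zero-linear = record
    { φ-[]    = refl
    ; φ-⊕     = λ _ _ → sym (+-identityʳ 0#)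
    ; φ-scale = λ a _ → sym (zeroʳ a)
    ; φ-0∷[]  = refl
    }

  -- Multiplication by X before evaluating or differentiating yields such a combination: x p(x) in
  -- the first case, p(x) + x p′(x) by the product rule in the second.
  combination-linear : ∀ {φ ψ} x → IsLinear φ → IsLinear ψ → IsLinear (λ p → φ p + x * ψ p)
  combination-linear {φ} {ψ} x φ-lin ψ-lin = record
    { φ-[]    = vanish Φ.φ-[] Ψ.φ-[]
    ; φ-⊕     = λ p q → trans (+-cong (Φ.φ-⊕ p q) (*-congˡ (Ψ.φ-⊕ p q)))
        (solve 5 (λ x a b c d → (a :+ b) :+ x :* (c :+ d) := (a :+ x :* c) :+ (b :+ x :* d))
          refl x (φ p) (φ q) (ψ p) (ψ q))
    ; φ-scale = λ a p → trans (+-cong (Φ.φ-scale a p) (*-congˡ (Ψ.φ-scale a p)))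
        (solve 4 (λ x a b c → a :* b :+ x :* (a :* c) := a :* (b :+ x :* c))
          refl x a (φ p) (ψ p))
    ; φ-0∷[]  = vanish Φ.φ-0∷[] Ψ.φ-0∷[]
    }
    where
    module Φ = IsLinear φ-lin
    module Ψ = IsLinear ψ-lin

    vanish : ∀ {y z} → y ≈ 0# → z ≈ 0# → y + x * z ≈ 0#
    vanish y≈0 z≈0 = trans (+-cong y≈0 (*-congˡ z≈0))
      (solve 1 (λ x → :0 :+ x :* :0 := :0) refl x)

  eval-linear : ∀ x → IsLinear (λ p → eval p x)
  eval-linear x = record
    { φ-[]    = refl
    ; φ-⊕     = eval-⊕
    ; φ-scale = eval-scale
    ; φ-0∷[]  = trans (+-identityˡ _) (zeroʳ x)
    }
    where
    eval-⊕ : ∀ p q → eval (p ⊕ q) x ≈ eval p x + eval q x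
    eval-⊕ []      q       = sym (+-identityˡ _)
    eval-⊕ (a ∷ p) []      = sym (+-identityʳ _)
    eval-⊕ (a ∷ p) (b ∷ q) = trans (+-congˡ (*-congˡ (eval-⊕ p q)))
      (solve 5 (λ x a b p q → (a :+ b) :+ x :* (p :+ q) := (a :+ x :* p) :+ (b :+ x :* q))
        refl x a b (eval p x) (eval q x))

    eval-scale : ∀ a p → eval (scale a p) x ≈ a * eval p x
    eval-scale a []      = sym (zeroʳ a)
    eval-scale a (b ∷ p) = trans (+-congˡ (*-congˡ (eval-scale a p)))
      (solve 4 (λ x a b p → a :* b :+ x :* (a :* p) := a :* (b :+ x :* p)) refl x a b (eval p x))

  coeff-linear : ∀ j → IsLinear (λ p → coeff p j)
  coeff-linear j = record
    { φ-[]    = refl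
    ; φ-⊕     = λ p q → coeff-⊕ p q j
    ; φ-scale = λ a p → coeff-scale a p j
    ; φ-0∷[]  = coeff-0∷[] j
    }
    where
    coeff-⊕ : ∀ p q j → coeff (p ⊕ q) j ≈ coeff p j + coeff q j
    coeff-⊕ []      q       j       = sym (+-identityˡ _)
    coeff-⊕ (a ∷ p) []      j       = sym (+-identityʳ _)
    coeff-⊕ (a ∷ p) (b ∷ q) zero    = refl
    coeff-⊕ (a ∷ p) (b ∷ q) (suc j) = coeff-⊕ p q j

    coeff-scale : ∀ a p j → coeff (scale a p) j ≈ a * coeff p j
    coeff-scale a []      j       = sym (zeroʳ a)
    coeff-scale a (b ∷ p) zero    = refl
    coeff-scale a (b ∷ p) (suc j) = coeff-scale a p j

    coeff-0∷[] : ∀ j → coeff (0# ∷ []) j ≈ 0#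
    coeff-0∷[] zero    = refl
    coeff-0∷[] (suc j) = refl

  derivative-∷ : ∀ x a p → eval (derivative (a ∷ p)) x ≈ eval p x + x * eval (derivative p) x
  derivative-∷ x a p = trans (IsLinear.φ-⊕ (eval-linear x) p (0# ∷ derivative p))
    (+-congˡ (+-identityˡ _))

  derivative-linear : ∀ x → IsLinear (λ p → eval (derivative p) x)
  derivative-linear x = record
    { φ-[]    = refl
    ; φ-⊕     = derivative-⊕
    ; φ-scale = derivative-scale
    ; φ-0∷[]  = E.φ-0∷[]
    }
    where
    module E = IsLinear (eval-linear x)

    derivative-⊕ : ∀ p q →
      eval (derivative (p ⊕ q)) x ≈ eval (derivative p) x + eval (derivative q) x
    derivative-⊕ []      q       = sym (+-identityˡ _)
    derivative-⊕ (a ∷ p) []      = sym (+-identityʳ _)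
    derivative-⊕ (a ∷ p) (b ∷ q) = begin
      eval (derivative ((a + b) ∷ (p ⊕ q))) x
        ≈⟨ derivative-∷ x (a + b) (p ⊕ q) ⟩
      eval (p ⊕ q) x + x * eval (derivative (p ⊕ q)) x
        ≈⟨ +-cong (E.φ-⊕ p q) (*-congˡ (derivative-⊕ p q)) ⟩
      (eval p x + eval q x) + x * (eval (derivative p) x + eval (derivative q) x)
        ≈⟨ solve 5 (λ x a b c d → (a :+ b) :+ x :* (c :+ d) := (a :+ x :* c) :+ (b :+ x :* d))
             refl x (eval p x) (eval q x) (eval (derivative p) x) (eval (derivative q) x) ⟩
      (eval p x + x * eval (derivative p) x) + (eval q x + x * eval (derivative q) x)
        ≈⟨ +-cong (derivative-∷ x a p) (derivative-∷ x b q) ⟨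
      eval (derivative (a ∷ p)) x + eval (derivative (b ∷ q)) x ∎

    derivative-scale : ∀ a p → eval (derivative (scale a p)) x ≈ a * eval (derivative p) x
    derivative-scale a []      = sym (zeroʳ a)
    derivative-scale a (b ∷ p) = begin
      eval (derivative (scale a (b ∷ p))) x
        ≈⟨ derivative-∷ x (a * b) (scale a p) ⟩
      eval (scale a p) x + x * eval (derivative (scale a p)) x
        ≈⟨ +-cong (E.φ-scale a p) (*-congˡ (derivative-scale a p)) ⟩
      a * eval p x + x * (a * eval (derivative p) x)
        ≈⟨ solve 4 (λ x a b c → a :* b :+ x :* (a :* c) := a :* (b :+ x :* c))
             refl x a (eval p x) (eval (derivative p) x) ⟩
      a * (eval p x + x * eval (derivative p) x)
        ≈⟨ *-congˡ (derivative-∷ x b p) ⟨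
      a * eval (derivative (b ∷ p)) x ∎

  P : ℕ → ℕ → Poly
  P = powerˢ kernel

  -2# : Carrier
  -2# = - fromℕ 2

  -- `kernel` is `[]` beyond t², so only two terms of a convolution with it matter. The remaining
  -- ones need this induction because their number is a variable.
  foldr-⊕-[] : ∀ m (f : ℕ → Poly) → (∀ i → f i ≡ []) → foldr _⊕_ [] (applyUpTo f m) ≡ []
  foldr-⊕-[] zero    f f≡[] = ≡.refl
  foldr-⊕-[] (suc m) f f≡[] rewrite f≡[] 0 = foldr-⊕-[] m (λ i → f (suc i)) (λ i → f≡[] (suc i))

  module Linear {φ : Poly → Carrier} (φ-linear : IsLinear φ) where
    open IsLinear φ-linear

    φ-sumUpTo : ∀ m f → φ (sumUpTo m f) ≈ ∑[k< suc m ] (λ i → φ (f i))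
    φ-sumUpTo m = φ-foldr (suc m)
      where
      φ-foldr : ∀ m f → φ (foldr _⊕_ [] (applyUpTo f m)) ≈ ∑[k< m ] (λ i → φ (f i))
      φ-foldr zero    f = φ-[]
      φ-foldr (suc m) f = begin
        φ (f 0 ⊕ foldr _⊕_ [] (applyUpTo (λ i → f (suc i)) m))  ≈⟨ φ-⊕ (f 0) _ ⟩
        φ (f 0) + φ (foldr _⊕_ [] (applyUpTo (λ i → f (suc i)) m))
          ≈⟨ +-congˡ (φ-foldr m (λ i → f (suc i))) ⟩
        φ (f 0) + ∑[k< m ] (λ i → φ (f (suc i)))                ≈⟨ ∑-front m (λ i → φ (f i)) ⟨
        ∑[k< suc m ] (λ i → φ (f i))                            ∎

    φ-C : ∀ m a → φ (C m a) ≈ ∑[k< suc m ] (λ k → binomial (- a) k * φ (P k m))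
    φ-C m a = trans (φ-sumUpTo m _) (∑-cong (suc m))
      where
      ∑-cong : ∀ N → ∑[k< N ] (λ k → φ (scale (binomial (- a) k) (P k m)))
        ≈ ∑[k< N ] (λ k → binomial (- a) k * φ (P k m))
      ∑-cong zero    = refl
      ∑-cong (suc N) = +-cong (∑-cong N) (φ-scale _ _)

    φ-1⊗ : ∀ p → φ ((1# ∷ []) ⊗ p) ≈ φ p
    φ-1⊗ p = begin
      φ (scale 1# p ⊕ (0# ∷ []))        ≈⟨ φ-⊕ _ _ ⟩
      φ (scale 1# p) + φ (0# ∷ [])      ≈⟨ +-cong (φ-scale 1# p) φ-0∷[] ⟩
      1# * φ p + 0#                     ≈⟨ solve 1 (λ p → :1 :* p :+ :0 := p) refl (φ p) ⟩
      φ p                               ∎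

    -- `ψ` plays the role of `φ` after multiplication by X.
    module _ {ψ : Poly → Carrier} (ψ-linear : IsLinear ψ) (φ-0∷ : ∀ p → φ (0# ∷ p) ≈ ψ p) where

      φ-2X⊗ : ∀ p → φ ((0# ∷ -2# ∷ []) ⊗ p) ≈ -2# * ψ p
      φ-2X⊗ p = begin
        φ (scale 0# p ⊕ (0# ∷ (scale -2# p ⊕ (0# ∷ []))))
          ≈⟨ φ-⊕ _ _ ⟩
        φ (scale 0# p) + φ (0# ∷ (scale -2# p ⊕ (0# ∷ [])))
          ≈⟨ +-cong (φ-scale 0# p) (φ-0∷ _) ⟩
        0# * φ p + ψ (scale -2# p ⊕ (0# ∷ []))
          ≈⟨ +-congˡ (Ψ.φ-⊕ _ _) ⟩
        0# * φ p + (ψ (scale -2# p) + ψ (0# ∷ []))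
          ≈⟨ +-congˡ (+-cong (Ψ.φ-scale -2# p) Ψ.φ-0∷[]) ⟩
        0# * φ p + (-2# * ψ p + 0#)
          ≈⟨ solve 2 (λ a b → :0 :* a :+ (b :+ :0) := b) refl (φ p) _ ⟩
        -2# * ψ p ∎
        where module Ψ = IsLinear ψ-linear

      -- Reads off the coefficient of t^m in (- 2 X t + t²) uᵏ: one shift for t, two for t², and `ψ`
      -- absorbs the factor X.
      φ-P-suc : ∀ k m → φ (P (suc k) m)
        ≈ -2# * shift (λ i → ψ (P k i)) m + 1# * shift (shift (λ i → φ (P k i))) m
      φ-P-suc k zero = trans φ-[]
        (solve 0 (:0 := (:- :2) :* :0 :+ :1 :* :0) refl)
      φ-P-suc k (suc zero) = begin
        φ (((0# ∷ -2# ∷ []) ⊗ P k 0) ⊕ [])        ≈⟨ φ-⊕ _ _ ⟩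
        φ ((0# ∷ -2# ∷ []) ⊗ P k 0) + φ []        ≈⟨ +-cong (φ-2X⊗ (P k 0)) φ-[] ⟩
        -2# * ψ (P k 0) + 0#                      ≈⟨ +-congˡ (zeroʳ 1#) ⟨
        -2# * ψ (P k 0) + 1# * 0#                 ∎
      φ-P-suc k (suc (suc m)) = begin
        φ (((0# ∷ -2# ∷ []) ⊗ P k (suc m)) ⊕ (((1# ∷ []) ⊗ P k m) ⊕ tail))
          ≡⟨ ≡.cong (λ r → φ (((0# ∷ -2# ∷ []) ⊗ P k (suc m)) ⊕ (((1# ∷ []) ⊗ P k m) ⊕ r)))
               (foldr-⊕-[] m tailTerm (λ _ → ≡.refl)) ⟩
        φ (((0# ∷ -2# ∷ []) ⊗ P k (suc m)) ⊕ (((1# ∷ []) ⊗ P k m) ⊕ []))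
          ≈⟨ trans (φ-⊕ _ _) (+-congˡ (φ-⊕ _ _)) ⟩
        φ ((0# ∷ -2# ∷ []) ⊗ P k (suc m)) + (φ ((1# ∷ []) ⊗ P k m) + φ [])
          ≈⟨ +-cong (φ-2X⊗ (P k (suc m))) (+-cong (φ-1⊗ (P k m)) φ-[]) ⟩
        -2# * ψ (P k (suc m)) + (φ (P k m) + 0#)
          ≈⟨ +-congˡ (solve 1 (λ a → a :+ :0 := :1 :* a) refl (φ (P k m))) ⟩
        -2# * ψ (P k (suc m)) + 1# * φ (P k m) ∎
        where
        tailTerm : ℕ → Poly
        tailTerm i = kernel (suc (suc (suc i))) ⊗ P k (suc (suc m) ℕ.∸ suc (suc (suc i)))
        tail : Poly
        tail = foldr _⊕_ [] (applyUpTo tailTerm m)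

  binomial-suc : ∀ α k → fromℕ (suc k) * binomial α (suc k) ≈ binomial α k * (α - fromℕ k)
  binomial-suc α k = ÷-cancel _ (suc k)

-- Differential equations of the generating function, turned into recurrences.

module GegenbauerRecurrences {ℓ₀ ℓ₁ ℓ₂ ℓ₃ : Level} (R : RealNumbers ℓ₀ ℓ₁ ℓ₂ ℓ₃) where
  open RealNumbers R
  open RealProperties R
  open Gegenbauer R
  open Sums R
  open PolynomialFunctionals R
  open SetoidReasoning setoid

  module Values (a x : Carrier) where

    b : ℕ → Carrier
    b = binomial (- a)

    p p′ : ℕ → ℕ → Carrier
    p  k m = eval (P k m) x
    p′ k m = eval (derivative (P k m)) x

    p-suc : ∀ k m → p (suc k) m ≈ -2# * x * shift (p k) m + shift (shift (p k)) m
    p-suc k m = begin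
      p (suc k) m
        -- `eval (0# ∷ p) x` unfolds to `0# + x * eval p x`; choosing exactly this combination as
        -- `ψ` makes the compatibility condition `refl`.
        ≈⟨ Linear.φ-P-suc (eval-linear x) (combination-linear x zero-linear (eval-linear x))
             (λ _ → refl) k m ⟩
      -2# * shift (λ i → 0# + x * p k i) m + 1# * shift (shift (p k)) m
        ≈⟨ +-congʳ (*-congˡ (trans
             (shift-cong (λ i → +-congʳ (sym (zeroʳ 0#))) m)
             (shift-linear 0# x (λ _ → 0#) (p k) m))) ⟩
      -2# * (0# * shift (λ _ → 0#) m + x * shift (p k) m) + 1# * shift (shift (p k)) m
        ≈⟨ solve 5 (λ u x z v w → u :* (:0 :* z :+ x :* v) :+ :1 :* w := u :* x :* v :+ w)
             refl -2# x (shift (λ _ → 0#) m) (shift (p k) m) (shift (shift (p k)) m) ⟩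
      -2# * x * shift (p k) m + shift (shift (p k)) m ∎

    p′-suc : ∀ k m → p′ (suc k) m
      ≈ -2# * (shift (p k) m + x * shift (p′ k) m) + shift (shift (p′ k)) m
    p′-suc k m = begin
      p′ (suc k) m
        ≈⟨ Linear.φ-P-suc (derivative-linear x)
             (combination-linear x (eval-linear x) (derivative-linear x))
             (derivative-∷ x 0#) k m ⟩
      -2# * shift (λ i → p k i + x * p′ k i) m + 1# * shift (shift (p′ k)) m
        ≈⟨ +-cong (*-congˡ (trans
             (shift-cong (λ i → +-congʳ (sym (*-identityˡ _))) m)
             (shift-linear 1# x (p k) (p′ k) m))) (*-identityˡ _) ⟩
      -2# * (1# * shift (p k) m + x * shift (p′ k) m) + shift (shift (p′ k)) m
        ≈⟨ +-congʳ (*-congˡ (+-congʳ (*-identityˡ _))) ⟩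
      -2# * (shift (p k) m + x * shift (p′ k) m) + shift (shift (p′ k)) m ∎

    -- u is divisible by t, so uᵏ starts at order k.
    p-vanish : ∀ {k m} → m ℕ.< k → p k m ≈ 0#
    p-vanish {suc k} {m} (s≤s m≤k) = trans (p-suc k m)
      (trans (+-cong (*-congˡ (first m m≤k)) (second m m≤k))
        (trans (+-identityʳ _) (zeroʳ _)))
      where
      first : ∀ m → m ℕ.≤ k → shift (p k) m ≈ 0#
      first zero    _   = refl
      first (suc m) m<k = p-vanish m<k
      second : ∀ m → m ℕ.≤ k → shift (shift (p k)) m ≈ 0#
      second zero          _   = refl
      second (suc zero)    _   = refl
      second (suc (suc m)) m<k = p-vanish (ℕₚ.<-trans (ℕₚ.n<1+n m) m<k)

    p′-zero : ∀ m → p′ 0 m ≈ 0#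
    p′-zero zero    = trans (+-identityˡ _) (zeroʳ x)
    p′-zero (suc m) = refl

    shift-p′-zero : ∀ m → shift (p′ 0) m ≈ 0#
    shift-p′-zero zero    = refl
    shift-p′-zero (suc m) = p′-zero m

    -- ∂ₓ uᵏ⁺¹ = - 2 (k + 1) t uᵏ for u = - 2 x t + t².
    p′-suc-closed : ∀ k m → p′ (suc k) m ≈ -2# * (fromℕ (suc k) * shift (p k) m)
    p′-suc-closed zero m = begin
      p′ 1 m
        ≈⟨ p′-suc 0 m ⟩
      -2# * (shift (p 0) m + x * shift (p′ 0) m) + shift (shift (p′ 0)) m
        ≈⟨ +-cong (*-congˡ (+-congˡ (*-congˡ (shift-p′-zero m)))) (shift²-p′-zero m) ⟩
      -2# * (shift (p 0) m + x * 0#) + 0#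
        ≈⟨ solve 3 (λ u v x → u :* (v :+ x :* :0) :+ :0 := u :* ((:1 :+ :0) :* v))
             refl -2# (shift (p 0) m) x ⟩
      -2# * (fromℕ 1 * shift (p 0) m) ∎
      where
      shift²-p′-zero : ∀ m → shift (shift (p′ 0)) m ≈ 0#
      shift²-p′-zero zero    = refl
      shift²-p′-zero (suc m) = shift-p′-zero m
    p′-suc-closed (suc k) zero = begin
      p′ (suc (suc k)) 0                   ≈⟨ p′-suc (suc k) 0 ⟩
      -2# * (0# + x * 0#) + 0#             ≈⟨ solve 3 (λ u x v →
        u :* (:0 :+ x :* :0) :+ :0 := u :* (v :* :0)) refl -2# x (fromℕ (suc (suc k))) ⟩
      -2# * (fromℕ (suc (suc k)) * 0#)     ∎
    -- Product rule for u times uᵏ⁺¹: differentiating u leaves uᵏ⁺¹, and the induction hypothesis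
    -- contributes k + 1 further copies, recombined by `p-suc`.
    p′-suc-closed (suc k) (suc m) = begin
      p′ (suc (suc k)) (suc m)
        ≈⟨ p′-suc (suc k) (suc m) ⟩
      -2# * (p (suc k) m + x * p′ (suc k) m) + shift (p′ (suc k)) m
        ≈⟨ +-cong (*-congˡ (+-congˡ (*-congˡ (p′-suc-closed k m)))) shifted ⟩
      -2# * (p (suc k) m + x * (-2# * (K * A))) + -2# * (K * A₂)
        ≈⟨ solve 6 (λ u x K v A A₂ → u :* (v :+ x :* (u :* (K :* A))) :+ u :* (K :* A₂)
             := u :* (v :+ K :* (u :* x :* A :+ A₂))) refl -2# x K (p (suc k) m) A A₂ ⟩
      -2# * (p (suc k) m + K * (-2# * x * A + A₂))
        ≈⟨ *-congˡ (+-congˡ (*-congˡ (p-suc k m))) ⟨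
      -2# * (p (suc k) m + K * p (suc k) m)
        ≈⟨ solve 3 (λ u K v → u :* (v :+ K :* v) := u :* ((:1 :+ K) :* v))
             refl -2# K (p (suc k) m) ⟩
      -2# * (fromℕ (suc (suc k)) * p (suc k) m) ∎
      where
      K A A₂ : Carrier
      K  = fromℕ (suc k)
      A  = shift (p k) m
      A₂ = shift (shift (p k)) m

      shifted : shift (p′ (suc k)) m ≈ -2# * (K * A₂)
      shifted = step m
        where
        step : ∀ m → shift (p′ (suc k)) m ≈ -2# * (K * shift (shift (p k)) m)
        step zero    = solve 2 (λ u v → :0 := u :* (v :* :0)) refl -2# K
        step (suc m) = p′-suc-closed k m

    -- The derivation (x - t) ∂ₓ - t ∂ₜ annihilates - 2 x t + t², hence its powers.
    euler : ∀ k m → x * p′ k m - shift (p′ k) m ≈ fromℕ m * p k m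
    euler zero m = trans
      (+-cong (*-congˡ (p′-zero m)) (-‿cong (shift-p′-zero m)))
      (trans (solve 1 (λ x → x :* :0 :- :0 := :0) refl x) (sym (m*p₀≈0 m)))
      where
      m*p₀≈0 : ∀ m → fromℕ m * p 0 m ≈ 0#
      m*p₀≈0 zero    = zeroˡ _
      m*p₀≈0 (suc m) = zeroʳ _
    euler (suc k) m = begin
      x * p′ (suc k) m - shift (p′ (suc k)) m
        ≈⟨ +-cong (*-congˡ (p′-suc k m)) (-‿cong (shift-p′-suc m)) ⟩
      x * (-2# * (A + x * A′) + A₂′) - (-2# * (A₂ + x * A₂′) + A₃′)
        ≈⟨ solve 6 (λ x A A₂ A′ A₂′ A₃′ → let u = :- :2 in
             x :* (u :* (A :+ x :* A′) :+ A₂′) :- (u :* (A₂ :+ x :* A₂′) :+ A₃′)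
             := u :* x :* A :+ :2 :* A₂ :+ u :* x :* (x :* A′ :- A₂′) :+ (x :* A₂′ :- A₃′))
             refl x A A₂ A′ A₂′ A₃′ ⟩
      -2# * x * A + fromℕ 2 * A₂ + -2# * x * (x * A′ - A₂′) + (x * A₂′ - A₃′)
        -- Delaying the identity for k by t and by t² turns the factor m into m - 1 and m - 2; the
        -- first two terms make up the difference.
        ≈⟨ +-cong (+-congˡ (*-congˡ (shifted-euler m))) (shifted²-euler m) ⟩
      -2# * x * A + fromℕ 2 * A₂ + -2# * x * ((fromℕ m - 1#) * A) + (fromℕ m - fromℕ 2) * A₂
        ≈⟨ solve 4 (λ x M A A₂ → let u = :- :2 in
             u :* x :* A :+ :2 :* A₂ :+ u :* x :* ((M :- :1) :* A) :+ (M :- :2) :* A₂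
             := M :* (u :* x :* A :+ A₂)) refl x (fromℕ m) A A₂ ⟩
      fromℕ m * (-2# * x * A + A₂)
        ≈⟨ *-congˡ (p-suc k m) ⟨
      fromℕ m * p (suc k) m ∎
      where
      A A₂ A′ A₂′ A₃′ : Carrier
      A   = shift (p k) m
      A₂  = shift (shift (p k)) m
      A′  = shift (p′ k) m
      A₂′ = shift (shift (p′ k)) m
      A₃′ = shift (shift (shift (p′ k))) m

      shift-p′-suc : ∀ m → shift (p′ (suc k)) m ≈
        -2# * (shift (shift (p k)) m + x * shift (shift (p′ k)) m)
          + shift (shift (shift (p′ k))) m
      shift-p′-suc zero    = solve 2 (λ u x → :0 := u :* (:0 :+ x :* :0) :+ :0) refl -2# x
      shift-p′-suc (suc m) = p′-suc k m

      x*0-0≈0 : x * 0# - 0# ≈ 0#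
      x*0-0≈0 = solve 1 (λ x → x :* :0 :- :0 := :0) refl x

      shifted-euler : ∀ m →
        x * shift (p′ k) m - shift (shift (p′ k)) m ≈ (fromℕ m - 1#) * shift (p k) m
      shifted-euler zero    = trans x*0-0≈0 (sym (zeroʳ _))
      shifted-euler (suc m) = trans (euler k m)
        (*-congʳ (solve 1 (λ m → m := :1 :+ m :- :1) refl (fromℕ m)))

      shifted²-euler : ∀ m → x * shift (shift (p′ k)) m - shift (shift (shift (p′ k))) m
        ≈ (fromℕ m - fromℕ 2) * shift (shift (p k)) m
      shifted²-euler zero    = trans x*0-0≈0 (sym (zeroʳ _))
      shifted²-euler (suc m) = trans (shifted-euler m)
        (*-congʳ (solve 1 (λ m → m :- :1 := :1 :+ m :- :2) refl (fromℕ m)))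

    p′-vanish : ∀ {k m} → m ℕ.< k → p′ k m ≈ 0#
    p′-vanish {suc k} {zero}  m<k = trans (p′-suc-closed k 0)
      (trans (*-congˡ (zeroʳ _)) (zeroʳ _))
    p′-vanish {suc k} {suc m} (s≤s m<k) = trans (p′-suc-closed k (suc m))
      (trans (*-congˡ (trans (*-congˡ (p-vanish m<k)) (zeroʳ _))) (zeroʳ _))

    c e : ℕ → Carrier
    c m = eval (C m a) x
    e m = eval (derivative (C m a)) x

    -- Terms with k > m vanish, so `j` of them may be appended. Sums belonging to adjacent indices
    -- thus get equal length.
    c≈∑ : ∀ j m → c m ≈ ∑[k< j ℕ.+ suc m ] (λ k → b k * p k m)
    c≈∑ j m = trans (Linear.φ-C (eval-linear x) m a)
      (sym (∑-extend j (suc m) λ k m<k → trans (*-congˡ (p-vanish m<k)) (zeroʳ _)))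

    e≈∑ : ∀ j m → e m ≈ ∑[k< j ℕ.+ suc m ] (λ k → b k * p′ k m)
    e≈∑ j m = trans (Linear.φ-C (derivative-linear x) m a)
      (sym (∑-extend j (suc m) λ k m<k → trans (*-congˡ (p′-vanish m<k)) (zeroʳ _)))

    shift-e≈∑ : ∀ m → shift e m ≈ ∑[k< suc (suc m) ] (λ k → b k * shift (p′ k) m)
    shift-e≈∑ zero    = sym (∑-zero 2 λ k _ → zeroʳ (b k))
    shift-e≈∑ (suc m) = e≈∑ 2 m

    -- (x - t) ∂ₓ F = t ∂ₜ F for F = (1 - 2 x t + t²)^(- a).
    xe-shift-e : ∀ m → x * e m - shift e m ≈ fromℕ m * c m
    xe-shift-e m = begin
      x * e m - shift e m
        ≈⟨ +-cong (*-congˡ (e≈∑ 1 m)) (-‿cong (shift-e≈∑ m)) ⟩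
      x * ∑[k< N ] (λ k → b k * p′ k m) - ∑[k< N ] (λ k → b k * shift (p′ k) m)
        ≈⟨ sums N ⟩
      fromℕ m * ∑[k< N ] (λ k → b k * p k m)
        ≈⟨ *-congˡ (c≈∑ 1 m) ⟨
      fromℕ m * c m ∎
      where
      N : ℕ
      N = suc (suc m)

      sums : ∀ N → x * ∑[k< N ] (λ k → b k * p′ k m) - ∑[k< N ] (λ k → b k * shift (p′ k) m)
        ≈ fromℕ m * ∑[k< N ] (λ k → b k * p k m)
      sums zero    = solve 2 (λ x m → x :* :0 :- :0 := m :* :0) refl x (fromℕ m)
      sums (suc N) = begin
        x * (S₁ + b N * p′ N m) - (S₂ + b N * shift (p′ N) m)
          ≈⟨ solve 6 (λ x S₁ S₂ b u v → x :* (S₁ :+ b :* u) :- (S₂ :+ b :* v)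
               := (x :* S₁ :- S₂) :+ b :* (x :* u :- v)) refl x S₁ S₂ (b N) _ _ ⟩
        (x * S₁ - S₂) + b N * (x * p′ N m - shift (p′ N) m)
          ≈⟨ +-cong (sums N) (*-congˡ (euler N m)) ⟩
        fromℕ m * S + b N * (fromℕ m * p N m)
          ≈⟨ solve 4 (λ m S b u → m :* S :+ b :* (m :* u) := m :* (S :+ b :* u))
               refl (fromℕ m) S (b N) _ ⟩
        fromℕ m * (S + b N * p N m) ∎
        where
        S S₁ S₂ : Carrier
        S  = ∑[k< N ] (λ k → b k * p k m)
        S₁ = ∑[k< N ] (λ k → b k * p′ k m)
        S₂ = ∑[k< N ] (λ k → b k * shift (p′ k) m)

    -- k pred-p k is the coefficient sequence of k uᵏ⁻¹; the value at k = 0 is irrelevant.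
    pred-p : ℕ → ℕ → Carrier
    pred-p zero    m = 0#
    pred-p (suc k) m = p k m

    -- The coefficient of t^(m+1) in (1 + u) ∂ₓ uᵏ = - 2 k t (uᵏ⁻¹ + uᵏ). The product u ∂ₓ uᵏ is
    -- obtained as ∂ₓ uᵏ⁺¹ + 2 t uᵏ.
    kernel-∂ₓ : ∀ k m → p′ k (suc m) - fromℕ 2 * x * p′ k m + shift (p′ k) m
      ≈ -2# * (fromℕ k * (pred-p k m + p k m))
    kernel-∂ₓ k m = begin
      p′ k (suc m) - fromℕ 2 * x * p′ k m + shift (p′ k) m
        ≈⟨ solve 5 (λ x v w z y → v :- :2 :* x :* w :+ z
             := v :+ ((:- :2) :* (y :+ x :* w) :+ z) :+ :2 :* y)
             refl x (p′ k (suc m)) (p′ k m) (shift (p′ k) m) (p k m) ⟩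
      p′ k (suc m) + (-2# * (p k m + x * p′ k m) + shift (p′ k) m) + fromℕ 2 * p k m
        ≈⟨ +-congʳ (+-congˡ (p′-suc k (suc m))) ⟨
      p′ k (suc m) + p′ (suc k) (suc m) + fromℕ 2 * p k m
        ≈⟨ +-congʳ (+-cong (p′-pred k) (p′-suc-closed k (suc m))) ⟩
      -2# * (fromℕ k * pred-p k m) + -2# * (fromℕ (suc k) * p k m) + fromℕ 2 * p k m
        ≈⟨ solve 3 (λ k u v → let w = :- :2 in
             w :* (k :* u) :+ w :* ((:1 :+ k) :* v) :+ :2 :* v := w :* (k :* (u :+ v)))
             refl (fromℕ k) (pred-p k m) (p k m) ⟩
      -2# * (fromℕ k * (pred-p k m + p k m)) ∎
      where
      p′-pred : ∀ k → p′ k (suc m) ≈ -2# * (fromℕ k * pred-p k m)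
      p′-pred zero    = solve 1 (λ u → :0 := u :* (:0 :* :0)) refl -2#
      p′-pred (suc k) = p′-suc-closed k (suc m)

    -- (1 - 2 x t + t²) ∂ₓ F = 2 a t F for F = (1 - 2 x t + t²)^(- a).
    e-three-term : ∀ m → e (suc m) - fromℕ 2 * x * e m + shift e m ≈ fromℕ 2 * a * c m
    e-three-term m = begin
      e (suc m) - fromℕ 2 * x * e m + shift e m
        ≈⟨ +-cong (+-cong (e≈∑ 0 (suc m)) (-‿cong (*-congˡ (e≈∑ 1 m)))) (shift-e≈∑ m) ⟩
      lhs N
        ≈⟨ sums N ⟩
      fromℕ 2 * a * ∑[k< N ] (λ k → b k * p k m) + fromℕ 2 * (fromℕ N * b N * p (suc m) m)
        -- The correction left after telescoping contains the coefficient of t^m in uᵐ⁺¹, which is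
        -- zero.
        ≈⟨ +-cong (*-congˡ (sym (c≈∑ 1 m))) (*-congˡ (*-congˡ (p-vanish (ℕₚ.n<1+n m)))) ⟩
      fromℕ 2 * a * c m + fromℕ 2 * (fromℕ N * b N * 0#)
        ≈⟨ solve 2 (λ u v → u :+ :2 :* (v :* :0) := u) refl _ _ ⟩
      fromℕ 2 * a * c m ∎
      where
      N : ℕ
      N = suc (suc m)

      lhs : ℕ → Carrier
      lhs N = ∑[k< N ] (λ k → b k * p′ k (suc m)) - fromℕ 2 * x * ∑[k< N ] (λ k → b k * p′ k m)
        + ∑[k< N ] (λ k → b k * shift (p′ k) m)

      -- The correction term is what telescopes, by (k + 1) b (k + 1) = b k (- a - k).
      sums : ∀ N → lhs N ≈ fromℕ 2 * a * ∑[k< N ] (λ k → b k * p k m)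
        + fromℕ 2 * (fromℕ N * b N * pred-p N m)
      sums zero    = solve 3 (λ x a b → :0 :- :2 :* x :* :0 :+ :0
        := :2 :* a :* :0 :+ :2 :* (:0 :* b :* :0)) refl x a (b 0)
      sums (suc N) = begin
        lhs (suc N)
          ≈⟨ solve 8 (λ x S₁ S₂ S₃ b u v w →
               (S₁ :+ b :* u) :- :2 :* x :* (S₂ :+ b :* v) :+ (S₃ :+ b :* w)
               := (S₁ :- :2 :* x :* S₂ :+ S₃) :+ b :* (u :- :2 :* x :* v :+ w))
               refl x _ _ _ (b N) _ _ _ ⟩
        lhs N + b N * (p′ N (suc m) - fromℕ 2 * x * p′ N m + shift (p′ N) m)
          ≈⟨ +-cong (sums N) (*-congˡ (kernel-∂ₓ N m)) ⟩
        (fromℕ 2 * a * S + fromℕ 2 * (fromℕ N * b N * pred-p N m))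
          + b N * (-2# * (fromℕ N * (pred-p N m + p N m)))
          ≈⟨ solve 6 (λ a S N b u v →
               (:2 :* a :* S :+ :2 :* (N :* b :* u)) :+ b :* ((:- :2) :* (N :* (u :+ v)))
               := :2 :* a :* (S :+ b :* v) :+ :2 :* (b :* ((:- a) :- N) :* v))
               refl a S (fromℕ N) (b N) (pred-p N m) (p N m) ⟩
        fromℕ 2 * a * (S + b N * p N m) + fromℕ 2 * (b N * (- a - fromℕ N) * p N m)
          ≈⟨ +-congˡ (*-congˡ (*-congʳ (binomial-suc (- a) N))) ⟨
        fromℕ 2 * a * (S + b N * p N m) + fromℕ 2 * (fromℕ (suc N) * b (suc N) * p N m) ∎
        where
        S : Carrier
        S = ∑[k< N ] (λ k → b k * p k m)

    c-zero : c 0 ≈ 1#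
    c-zero = trans (c≈∑ 0 0) (solve 1 (λ x → :0 :+ :1 :* (:1 :+ x :* :0) := :1) refl x)

    e-zero : e 0 ≈ 0#
    e-zero = trans (e≈∑ 0 0) (trans (+-identityˡ _) (trans (*-congˡ (p′-zero 0)) (zeroʳ _)))

    -- The two differential equations are added, which eliminates e (m - 1).
    e-suc : ∀ m → e (suc m) ≈ x * e m + (fromℕ m + fromℕ 2 * a) * c m
    e-suc m = begin
      e (suc m)
        ≈⟨ solve 4 (λ x e e′ s → e′ := (e′ :- :2 :* x :* e :+ s) :+ (x :* e :- s) :+ x :* e)
             refl x (e m) (e (suc m)) (shift e m) ⟩
      (e (suc m) - fromℕ 2 * x * e m + shift e m) + (x * e m - shift e m) + x * e m
        ≈⟨ +-congʳ (+-cong (e-three-term m) (xe-shift-e m)) ⟩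
      fromℕ 2 * a * c m + fromℕ m * c m + x * e m
        ≈⟨ solve 4 (λ a m c u → :2 :* a :* c :+ m :* c :+ u := u :+ (m :+ :2 :* a) :* c)
             refl a (fromℕ m) (c m) _ ⟩
      x * e m + (fromℕ m + fromℕ 2 * a) * c m ∎

    c-suc : ∀ m → fromℕ (suc m) * c (suc m) ≈ x * e (suc m) - e m
    c-suc m = sym (xe-shift-e (suc m))

-- Degree and leading coefficient.

module GegenbauerDegree {ℓ₀ ℓ₁ ℓ₂ ℓ₃ : Level} (R : RealNumbers ℓ₀ ℓ₁ ℓ₂ ℓ₃) where
  open RealNumbers R
  open RealProperties R
  open Gegenbauer R
  open Sums R
  open PolynomialFunctionals R
  open SetoidReasoning setoid

  module PositiveParameter (a : Carrier) (0<a : 0# < a) where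

    coeff-P-suc : ∀ k m j → coeff (P (suc k) m) (suc j)
      ≈ -2# * shift (λ i → coeff (P k i) j) m + 1# * shift (shift (λ i → coeff (P k i) (suc j))) m
    coeff-P-suc k m j =
      Linear.φ-P-suc (coeff-linear (suc j)) (coeff-linear j) (λ _ → refl) k m

    -- In u the exponent of X never exceeds that of t, a property inherited by powers.
    coeff-P-vanish : ∀ k {m j} → m ℕ.< j → coeff (P k m) j ≈ 0#
    coeff-P-vanish zero    {zero}      {suc j} _         = refl
    coeff-P-vanish zero    {suc m}     {suc j} _         = refl
    coeff-P-vanish (suc k) {m}         {suc j} (s≤s m≤j) = trans (coeff-P-suc k m j)
      (trans (+-cong (*-congˡ (first m m≤j)) (*-congˡ (second m m≤j)))
        (solve 1 (λ u → u :* :0 :+ :1 :* :0 := :0) refl -2#))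
      where
      first : ∀ m → m ℕ.≤ j → shift (λ i → coeff (P k i) j) m ≈ 0#
      first zero    _   = refl
      first (suc m) m<j = coeff-P-vanish k m<j
      second : ∀ m → m ℕ.≤ j → shift (shift (λ i → coeff (P k i) (suc j))) m ≈ 0#
      second zero          _   = refl
      second (suc zero)    _   = refl
      second (suc (suc m)) m<j = coeff-P-vanish k (ℕₚ.<-trans (ℕₚ.n<1+n m) (ℕₚ.m<n⇒m<1+n m<j))

    -- Only the term - 2 X t of u raises both exponents equally; t² would leave a coefficient above
    -- the diagonal.
    coeff-P-diagonal : ∀ k m → coeff (P (suc k) (suc m)) (suc m) ≈ -2# * coeff (P k m) m
    coeff-P-diagonal k m = trans (coeff-P-suc k (suc m) m)
      (trans (+-congˡ (*-congˡ (vanish m)))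
        (solve 1 (λ u → u :+ :1 :* :0 := u) refl _))
      where
      vanish : ∀ m → shift (λ i → coeff (P k i) (suc m)) m ≈ 0#
      vanish zero    = refl
      vanish (suc m) = coeff-P-vanish k (ℕₚ.m<n⇒m<1+n (ℕₚ.n<1+n m))

    coeff-P-below-diagonal : ∀ {k m} → k ℕ.< m → coeff (P k m) m ≈ 0#
    coeff-P-below-diagonal {zero}  {suc m} _         = refl
    coeff-P-below-diagonal {suc k} {suc m} (s≤s k<m) = trans (coeff-P-diagonal k m)
      (trans (*-congˡ (coeff-P-below-diagonal k<m)) (zeroʳ _))

    -- This is 2^m a (a + 1) ⋯ (a + m - 1) / m!, the contribution of k = m to the coefficient of
    -- X^m.
    leading : ℕ → Carrier
    leading m = binomial (- a) m * coeff (P m m) m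

    -- Consecutive values have ratio 2 (a + m) / (m + 1): the negative factors - a - m and - 2
    -- cancel in sign.
    leading-pos : ∀ m → 0# < leading m
    leading-pos zero    = <.<-respʳ-≈ (sym (*-identityˡ 1#)) 0<1
    leading-pos (suc m) = *-cancel-pos (0<fromℕ m) (<.<-respʳ-≈ (begin
      (fromℕ 2 * (a + fromℕ m)) * leading m
        ≈⟨ solve 4 (λ a m b u → (:2 :* (a :+ m)) :* (b :* u)
             := (b :* ((:- a) :- m)) :* ((:- :2) :* u)) refl a (fromℕ m) (binomial (- a) m) _ ⟩
      (binomial (- a) m * (- a - fromℕ m)) * (-2# * coeff (P m m) m)
        ≈⟨ *-cong (binomial-suc (- a) m) (coeff-P-diagonal m m) ⟨
      (fromℕ (suc m) * binomial (- a) (suc m)) * coeff (P (suc m) (suc m)) (suc m)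
        ≈⟨ *-assoc _ _ _ ⟩
      fromℕ (suc m) * leading (suc m) ∎)
      (*-pos (*-pos (0<fromℕ 1) (pos+nonneg 0<a (0≤fromℕ m))) (leading-pos m)))

    C-hasDegree : ∀ m → HasDegree (C m a) m
    C-hasDegree m = 0<⇒#0 (<.<-respʳ-≈ leading≈ (leading-pos m)) , λ j m<j → begin
      coeff (C m a) j
        ≈⟨ Linear.φ-C (coeff-linear j) m a ⟩
      ∑[k< suc m ] (λ k → binomial (- a) k * coeff (P k m) j)
        ≈⟨ ∑-zero (suc m) (λ k _ → trans (*-congˡ (coeff-P-vanish k m<j)) (zeroʳ _)) ⟩
      0# ∎
      where
      leading≈ : leading m ≈ coeff (C m a) m
      leading≈ = begin
        leading m
          ≈⟨ +-identityˡ _ ⟨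
        0# + leading m
          ≈⟨ +-congʳ (∑-zero m λ k k<m → trans (*-congˡ (coeff-P-below-diagonal k<m)) (zeroʳ _)) ⟨
        ∑[k< suc m ] (λ k → binomial (- a) k * coeff (P k m) m)
          ≈⟨ Linear.φ-C (coeff-linear m) m a ⟨
        coeff (C m a) m ∎

-- From the hypotheses on s and t to the Cauchy transform.

module CauchyTransformBound {ℓ₀ ℓ₁ ℓ₂ ℓ₃ : Level} (R : RealNumbers ℓ₀ ℓ₁ ℓ₂ ℓ₃) where
  open RealNumbers R
  open Gegenbauer R
  open RealProperties R
  open SetoidReasoning setoid

  module AtPoint
    (n d-1 : ℕ) (γ : Carrier) (γ-sqrt : IsSqrt γ (γ² n (suc d-1)))
    (s t : Carrier) (γ<s : γ < s) (0<t : 0# < t) (0≤f : 0# ≤ f n (suc d-1) s t)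
    where
    open GegenbauerRecurrences.Values R (fromℕ (suc n)) s
    open GegenbauerInequality.Recurrence R n s c e c-zero e-zero e-suc c-suc

    d : ℕ
    d = suc d-1

    D : Carrier
    D = fromℕ d

    0<s : 0# < s
    0<s = ≤-<-trans (proj₁ γ-sqrt) γ<s

    s²≥γ² : 0# ≤ s * s - γ² n d
    s²≥γ² = ≤-respʳ-≈ (trans
      (solve 2 (λ s γ → (s :- γ) :* (s :+ γ) := s :* s :- γ :* (γ :* :1)) refl s γ)
      (+-congˡ (-‿cong (proj₂ γ-sqrt))))
      (*-nonneg (<⇒≤ (x<y⇒0<y-x γ<s)) (+-nonneg (<⇒≤ 0<s) (proj₁ γ-sqrt)))

    [n+d]²γ² : (N + D) * (N + D) * γ² n d ≈ D * (D + fromℕ 2 * N)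
    [n+d]²γ² = begin
      (N + D) * (N + D) * γ² n d
        ≈⟨ solve 2 (λ u v → u :* (:1 :- v) := u :- u :* v) refl _ _ ⟩
      (N + D) * (N + D) - (N + D) * (N + D) * (fromℕ (n ℕ.^ 2) ÷ ((n ℕ.+ d) ℕ.^ 2))
        ≈⟨ +-congˡ (-‿cong (*-congʳ (trans (fromℕ-^2 (n ℕ.+ d))
             (*-cong (fromℕ-+ n d) (fromℕ-+ n d))))) ⟨
      (N + D) * (N + D) - fromℕ ((n ℕ.+ d) ℕ.^ 2) * (fromℕ (n ℕ.^ 2) ÷ ((n ℕ.+ d) ℕ.^ 2))
        ≈⟨ +-congˡ (-‿cong (trans (÷-cancel _ ((n ℕ.+ d) ℕ.^ 2)) (fromℕ-^2 n))) ⟩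
      (N + D) * (N + D) - N * N
        ≈⟨ solve 2 (λ N D → (N :+ D) :* (N :+ D) :- N :* N := D :* (D :+ :2 :* N)) refl N D ⟩
      D * (D + fromℕ 2 * N) ∎
      where
      -- Proofs of `NonZero` are irrelevant in `_÷_`, so this instance yields the same quotient as
      -- the one inside `γ²`.
      instance
        [n+d]²≢0 : NonZero ((n ℕ.+ d) ℕ.^ 2)
        [n+d]²≢0 = ℕₚ.m^n≢0 (n ℕ.+ d) 2
          {{ℕ.>-nonZero (ℕₚ.<-≤-trans (ℕ.>-nonZero⁻¹ d) (ℕₚ.m≤n+m d n))}}

      fromℕ-^2 : ∀ k → fromℕ (k ℕ.^ 2) ≈ fromℕ k * fromℕ k
      fromℕ-^2 k = trans (fromℕ-* k (k ℕ.* 1)) (*-congˡ (trans (fromℕ-* k 1)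
        (solve 1 (λ k → k :* (:1 :+ :0) := k) refl (fromℕ k))))

    -- The discriminant at `d` is (n + d)² (s² - γ²); the threshold γ is where it vanishes.
    B²≥D[D+2N] : 0# ≤ discriminant d
    B²≥D[D+2N] = ≤-respʳ-≈ (trans
      (solve 3 (λ u s v → u :* u :* (s :* s :- v) := (u :* s) :* (u :* s) :- u :* u :* v)
        refl (N + D) s (γ² n d))
      (+-congˡ (-‿cong [n+d]²γ²)))
      (*-nonneg (*-nonneg 0≤N+D 0≤N+D) s²≥γ²)
      where
      0≤N+D : 0# ≤ N + D
      0≤N+D = +-nonneg (0≤fromℕ n) (0≤fromℕ d)

    open Positivity d-1 0<s B²≥D[D+2N] using (c-pos)

    F≥0 : 0# ≤ F t d
    F≥0 = ≤-respʳ-≈ (begin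
      f n d s t
        ≈⟨ +-cong (+-congˡ (*-congʳ (*-congʳ (fromℕ-* 2 n))))
             (-‿cong (trans (fromℕ-+ (2 ℕ.* n) d) (+-congʳ (fromℕ-* 2 n)))) ⟩
      D * (s ^ 2 - 1#) * t ^ 2 + fromℕ 2 * N * s * t - (fromℕ 2 * N + D)
        ≈⟨ solve 4 (λ s t N D →
             D :* (s :* (s :* :1) :- :1) :* (t :* (t :* :1)) :+ :2 :* N :* s :* t :- (:2 :* N :+ D)
             := D :* ((s :* s :- :1) :* (t :* t) :- :1) :+ :2 :* N :* (s :* t :- :1))
             refl s t N D ⟩
      F t d ∎) 0≤f

    open DerivativeBound d-1 t 0<s 0<t F≥0 (λ k≤d → <⇒≤ (c-pos k≤d)) using (e≤ktc)

    0<c : 0# < c d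
    0<c = c-pos ℕₚ.≤-refl

    domain : CauchyDomain (C d (fromℕ (suc n))) s
    domain = record
      { degree       = d
      ; hasDegree    = GegenbauerDegree.PositiveParameter.C-hasDegree R (fromℕ (suc n)) (0<fromℕ n) d
      ; nonvanishing = 0<⇒#0 0<c
      }

    -- Multiplying the difference of the two sides by the positive `D` and `c d` clears both
    -- divisions and leaves `e≤ktc` at k = d.
    bound : 𝒢 (C d (fromℕ (suc n))) s domain ≤ t
    bound = 0≤y-x⇒x≤y (*-cancel-nonneg (0<fromℕ d-1) (*-cancel-nonneg 0<c (≤-respʳ-≈ (begin
      D * t * c d - e d
        ≈⟨ solve 4 (λ D t c e → D :* t :* c :- e := c :* D :* t :- :1 :* e) refl D t (c d) (e d) ⟩
      c d * D * t - 1# * e d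
        ≈⟨ +-congˡ (-‿cong (*-congʳ (*-recip (c d) (0<⇒#0 0<c)))) ⟨
      c d * D * t - c d * r * e d
        ≈⟨ solve 5 (λ c D t r e → c :* D :* t :- c :* r :* e := c :* (D :* t :- e :* r))
             refl (c d) D t r (e d) ⟩
      c d * (D * t - e d * r)
        ≈⟨ *-congˡ (+-congˡ (-‿cong (÷-cancel (e d * r) d))) ⟨
      c d * (D * t - D * ((e d * r) ÷ d))
        ≈⟨ *-congˡ (solve 3 (λ D t g → D :* t :- D :* g := D :* (t :- g)) refl D t _) ⟩
      c d * (D * (t - (e d * r) ÷ d)) ∎)
      (e≤ktc ℕₚ.≤-refl))))
      where
      r : Carrier
      r = recip (c d) (0<⇒#0 0<c)

-- That the transform is defined at `s` is part of the conclusion; it rests on `c d` being positive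
-- and on the degree computation.
theorem6p11 :
    {c ℓ₁ ℓ₂ ℓ₃ : Level} (R : RealNumbers c ℓ₁ ℓ₂ ℓ₃) →
    let open RealNumbers R
        open Gegenbauer R
    in
    (n d : ℕ) .{{_ : NonZero d}} (γ : Carrier) → IsSqrt γ (γ² n d) →
    (s t : Carrier) → γ < s → 0# < t → 0# ≤ f n d s t →
    Σ[ dom ∈ CauchyDomain (C d (fromℕ (suc n))) s ]
      𝒢 (C d (fromℕ (suc n))) s dom ≤ t
theorem6p11 R n (suc d-1) γ γ-sqrt s t γ<s 0<t 0≤f = domain , bound
  where open CauchyTransformBound.AtPoint R n d-1 γ γ-sqrt s t γ<s 0<t 0≤f
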